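{- Let $k$ be a positive integer with $k \equiv 2 \pmod{15}$ and let \[ n = L_{CC}(10,k) = \frac{512k^5+1280k^4+6080k^3+7840k^2+10010k+3741}{3125}. \] Then there is an undirected Cayley graph of the cyclic group $\mathbb{Z}_n$ on five generators which has diameter $k$. Moreover, a generating set for such a graph is \[ \Big\{1,\ \tfrac{128k^4+256k^3+1192k^2+1064k+883}{625},\ \tfrac{512k^5+640k^4+4000k^3-1320k^2-6660k-11899}{9375},\ \tfrac{512k^5+640k^4+4000k^3-1320k^2+840k-8149}{9375},\ \tfrac{512k^5+640k^4+6400k^3+2280k^2+13890k-2224}{9375}\Big\}, \] i.e. the Cayley graph of $\mathbb{Z}_n$ with connection set $\{\pm g_1,\dots,\pm g_5\}$, where $g_1,\dots,g_5$ are these integers taken modulo $n$, has diameter $k$.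
   Context: For a positive integer $n$ and integers $g_1,\dots,g_5$, the undirected Cayley (circulant) graph of the cyclic group $\mathbb{Z}_n$ with generating set $\{g_1,\dots,g_5\}$ has vertex set $\mathbb{Z}_n$, with $i$ and $j$ adjacent if and only if $j-i \equiv \pm g_t \pmod n$ for some $t$. Its diameter is the maximum over pairs of vertices of the graph distance. The notation $L_{CC}(10,k)$ is just a name for the displayed polynomial value. -}

module Defs where

open import Data.Nat using (ℕ; zero; suc; _≤_; _<_)
open import Data.Integer using (ℤ; +_; _+_; _-_; _*_; -_; _/ℕ_; ∣_∣)
open import Data.Integer.Divisibility using (_∣_)
open import Data.Fin using (Fin)
import Data.Fin as Fin
open import Data.Product using (_×_; ∃; Σ)
open import Data.Sum using (_⊎_)

-- Undirected circulant (Cayley) graph of ℤ_n with five generators.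
-- Vertices are the natural numbers 0 … n-1 (representatives of ℤ_n);
-- the generators are arbitrary integers (taken modulo n).

Gens : Set
Gens = Fin 5 → ℤ

Adj : ℕ → Gens → ℕ → ℕ → Set
Adj n g i j = ∃ λ (t : Fin 5) →
  ((+ n) ∣ ((+ j - + i) - g t)) ⊎ ((+ n) ∣ ((+ j - + i) + g t))

data Walk (n : ℕ) (g : Gens) : ℕ → ℕ → ℕ → Set where
  here : ∀ {i} → i < n → Walk n g zero i i
  step : ∀ {m i j l} → Walk n g m i j → l < n → Adj n g j l → Walk n g (suc m) i l

Dist : ℕ → Gens → ℕ → ℕ → ℕ → Set
Dist n g i j d = Walk n g d i j × (∀ m → Walk n g m i j → d ≤ m)

Diameter : ℕ → Gens → ℕ → Set
Diameter n g d =
  (∀ i j → i < n → j < n → Σ ℕ λ e → Dist n g i j e × e ≤ d)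
  × (∃ λ i → ∃ λ j → i < n × j < n × Dist n g i j d)

-- The specific parameters of the theorem (all divisions are exact
-- under the hypothesis k ≡ 2 mod 15).

LCC10 : ℕ → ℤ
LCC10 k = (+ 512 * K ^5 + + 1280 * K ^4 + + 6080 * K ^3 + + 7840 * K ^2
           + + 10010 * K + + 3741) /ℕ 3125
  where
  K = + k
  _^2 _^3 _^4 _^5 : ℤ → ℤ
  x ^2 = x * x
  x ^3 = x * x * x
  x ^4 = x * x * x * x
  x ^5 = x * x * x * x * x
  infix 9 _^2 _^3 _^4 _^5

gen : ℕ → Gens
gen k Fin.zero = + 1
gen k (Fin.suc Fin.zero) =
  (+ 128 * K ^4 + + 256 * K ^3 + + 1192 * K ^2 + + 1064 * K + + 883) /ℕ 625
  where
  K = + k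
  _^2 _^3 _^4 : ℤ → ℤ
  x ^2 = x * x
  x ^3 = x * x * x
  x ^4 = x * x * x * x
  infix 9 _^2 _^3 _^4
gen k (Fin.suc (Fin.suc Fin.zero)) =
  (+ 512 * K ^5 + + 640 * K ^4 + + 4000 * K ^3 - + 1320 * K ^2
   - + 6660 * K - + 11899) /ℕ 9375
  where
  K = + k
  _^2 _^3 _^4 _^5 : ℤ → ℤ
  x ^2 = x * x
  x ^3 = x * x * x
  x ^4 = x * x * x * x
  x ^5 = x * x * x * x * x
  infix 9 _^2 _^3 _^4 _^5
gen k (Fin.suc (Fin.suc (Fin.suc Fin.zero))) =
  (+ 512 * K ^5 + + 640 * K ^4 + + 4000 * K ^3 - + 1320 * K ^2
   + + 840 * K - + 8149) /ℕ 9375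
  where
  K = + k
  _^2 _^3 _^4 _^5 : ℤ → ℤ
  x ^2 = x * x
  x ^3 = x * x * x
  x ^4 = x * x * x * x
  x ^5 = x * x * x * x * x
  infix 9 _^2 _^3 _^4 _^5
gen k (Fin.suc (Fin.suc (Fin.suc (Fin.suc Fin.zero)))) =
  (+ 512 * K ^5 + + 640 * K ^4 + + 6400 * K ^3 + + 2280 * K ^2
   + + 13890 * K - + 2224) /ℕ 9375
  where
  K = + k
  _^2 _^3 _^4 _^5 : ℤ → ℤ
  x ^2 = x * x
  x ^3 = x * x * x
  x ^4 = x * x * x * x
  x ^5 = x * x * x * x * x
  infix 9 _^2 _^3 _^4 _^5

{-# OPTIONS --safe #-}

-- Write k = 15m + 2. The vectors a ∈ ℤ⁵ with a·g ≡ 0 (mod n) form a lattice that is close to 6m times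
-- the body-centred cubic lattice: it is generated by the rows uᵢ of the matrix 12m I + C, where C − 2I
-- is skew-symmetric with entries 0 and ±1, together with ½(u₁ + ⋯ + u₅). By the skew symmetry each of
-- the 32 corners ½(±u₁ ± ⋯ ± u₅) has ℓ¹-norm exactly 2k + 1.
--
-- Upper bound. Let ‖x‖ = k + 1 and suppose that no ±uᵢ brings x closer to 0. If no coordinate of x
-- vanishes, this forces ∣xᵢ∣ ≤ ∣vᵢ∣ for the corner v in the orthant of x, hence
-- ‖x − v‖ = (2k + 1) − (k + 1) = k. When some coordinates vanish, corners of neighbouring orthants and
-- sums ±uᵢ ± uⱼ are needed as well; a finite tree of boxes whose thresholds are linear in m assigns a
-- lattice vector to every case. As 1 is a generator, induction on j then shows that every residue j
-- is represented by a vector of norm at most k.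
--
-- Lower bound. There is a w of norm k, roughly half of a corner, such that w and its mirror image have
-- all coordinates near 3m; translating such a point by ±uᵢ raises the norm by about 12m − 2wᵢ, so w is
-- shortest in its class.
--
-- For m = 0 the graph has 45 vertices and is checked directly.
module Submission where

open import Defs
open import Algebra.Properties.CommutativeSemigroup using (interchange)
open import Data.Bool using (Bool; true; false; T; _∧_; _∨_; _xor_; if_then_else_)
open import Data.Bool.Properties using (T-∧; T-∨)
open import Data.Fin using (Fin; zero; suc)
open import Data.Fin.Patterns using (0F; 1F; 2F; 3F; 4F)
import Data.Fin.Properties as Fin
open import Data.Integer as ℤ using (ℤ; +_; -[1+_]; _+_; _-_; _*_; -_; ∣_∣; _≤_; _≤ᵇ_)
open import Data.Integer.DivMod using (_/ℕ_; _%ℕ_; n%ℕd<d; a≡a%ℕn+[a/ℕn]*n)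
open import Data.Integer.Divisibility.Signed
import Data.Integer.Properties as ℤ
open import Data.Integer.Tactic.RingSolver using (solve-∀)
open import Data.List as List using (List; []; _∷_)
open import Data.List.Membership.Propositional using (find)
import Data.List.Relation.Unary.All as ListAll
open import Data.List.Relation.Unary.Any as Any using (Any)
open import Data.Nat as ℕ using (ℕ; zero; suc; z≤n; s≤s; _<_; _%_; _/_; _≡ᵇ_)
import Data.Nat.Divisibility as ℕ
open import Data.Nat.DivMod using (m≡m%n+[m/n]*n; m*n/n≡m)
open import Data.Nat.Induction using (<-rec)
import Data.Nat.Properties as ℕ
import Data.Nat.Tactic.RingSolver as ℕ
open import Data.Product using (Σ; _×_; _,_; ∃-syntax; proj₁; proj₂)
open import Data.Sum using (_⊎_; inj₁; inj₂)
open import Data.Unit using (tt)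
open import Data.Vec as Vec using (Vec; []; _∷_; map; replicate; tabulate; zipWith)
import Data.Vec.Properties as Vec
open import Data.Vec.Relation.Binary.Pointwise.Inductive using (Pointwise; []; _∷_)
open import Data.Vec.Relation.Unary.All using (All; []; _∷_)
open import Function using (_∘_; Equivalence)
open import Relation.Binary.PropositionalEquality
open import Relation.Nullary using (Dec; yes; no; contradiction)
open import Relation.Nullary.Decidable using (from-no; from-yes; map′; ¬?; _×-dec_; _⊎-dec_)

open Equivalence using (to)

private variable
  p r s : ℕ

-- Integer vectors: inner product and ℓ¹-norm.

dot : Vec ℤ p → Vec ℤ p → ℤ
dot []       []       = + 0
dot (a ∷ as) (b ∷ bs) = a * b + dot as bs

norm : Vec ℤ p → ℕ
norm []       = 0
norm (a ∷ as) = ∣ a ∣ ℕ.+ norm as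

infixl 6 _⊕_ _⊝_
_⊕_ _⊝_ : Vec ℤ p → Vec ℤ p → Vec ℤ p
_⊕_ = zipWith _+_
_⊝_ = zipWith _-_

dot-⊕ : (a b c : Vec ℤ p) → dot (a ⊕ b) c ≡ dot a c + dot b c
dot-⊕ []       []       []       = refl
dot-⊕ (a ∷ as) (b ∷ bs) (c ∷ cs) rewrite dot-⊕ as bs cs =
  regroup a b c (dot as cs) (dot bs cs)
  where
  regroup : ∀ a b c s t → (a + b) * c + (s + t) ≡ (a * c + s) + (b * c + t)
  regroup = solve-∀

dot-⊝ : (a b c : Vec ℤ p) → dot (a ⊝ b) c ≡ dot a c - dot b c
dot-⊝ []       []       []       = refl
dot-⊝ (a ∷ as) (b ∷ bs) (c ∷ cs) rewrite dot-⊝ as bs cs =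
  regroup a b c (dot as cs) (dot bs cs)
  where
  regroup : ∀ a b c s t → (a - b) * c + (s - t) ≡ (a * c + s) - (b * c + t)
  regroup = solve-∀

norm-⊕ : (a b : Vec ℤ p) → norm (a ⊕ b) ℕ.≤ norm a ℕ.+ norm b
norm-⊕ []       []       = z≤n
norm-⊕ (a ∷ as) (b ∷ bs) = begin
  ∣ a + b ∣ ℕ.+ norm (as ⊕ bs)                ≤⟨ ℕ.+-mono-≤ (ℤ.∣i+j∣≤∣i∣+∣j∣ a b) (norm-⊕ as bs) ⟩
  ∣ a ∣ ℕ.+ ∣ b ∣ ℕ.+ (norm as ℕ.+ norm bs)   ≡⟨ interchange ℕ.+-commutativeSemigroup ∣ a ∣ ∣ b ∣ (norm as) (norm bs) ⟩
  ∣ a ∣ ℕ.+ norm as ℕ.+ (∣ b ∣ ℕ.+ norm bs)   ∎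
  where open ℕ.≤-Reasoning

norm-map-neg : (a : Vec ℤ p) → norm (map -_ a) ≡ norm a
norm-map-neg []       = refl
norm-map-neg (a ∷ as) = cong₂ ℕ._+_ (ℤ.∣-i∣≡∣i∣ a) (norm-map-neg as)

zeros : Vec ℤ p
zeros = replicate _ (+ 0)

dot-zeros : (c : Vec ℤ p) → dot zeros c ≡ + 0
dot-zeros []       = refl
dot-zeros (c ∷ cs) rewrite dot-zeros cs = refl

norm-zeros : ∀ p → norm (zeros {p}) ≡ 0
norm-zeros zero    = refl
norm-zeros (suc p) = norm-zeros p

unit : ℤ → Fin p → Vec ℤ p
unit s zero    = s ∷ zeros
unit s (suc t) = + 0 ∷ unit s t

norm-unit : ∀ s (t : Fin p) → norm (unit s t) ≡ ∣ s ∣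
norm-unit {suc p} s zero rewrite norm-zeros p = ℕ.+-identityʳ ∣ s ∣
norm-unit s (suc t) = norm-unit s t

dot-unit : ∀ s (t : Fin p) (f : Fin p → ℤ) → dot (unit s t) (tabulate f) ≡ s * f t
dot-unit s zero    f rewrite dot-zeros (tabulate (f ∘ suc)) = ℤ.+-identityʳ _
dot-unit s (suc t) f rewrite dot-unit s t (f ∘ suc) = ℤ.+-identityˡ _

-- Walks in a circulant graph as integer vectors modulo n.

module Circulant (n : ℕ) .{{_ : ℕ.NonZero n}} (g : Gens) where

  infix 4 _≋_
  record _≋_ (x y : ℤ) : Set where
    constructor mod
    field n∣x-y : + n ∣ x - y

  ≋-reflexive : ∀ {x y} → x ≡ y → x ≋ y
  ≋-reflexive {x} refl = mod (subst (+ n ∣_) (sym (ℤ.+-inverseʳ x)) (∣ᵤ⇒∣ (n ℕ.∣0)))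

  ≋-sym : ∀ {x y} → x ≋ y → y ≋ x
  ≋-sym {x} {y} (mod d) = mod (subst (+ n ∣_) (eq x y) (∣m⇒∣-m d))
    where
    eq : ∀ x y → - (x - y) ≡ y - x
    eq = solve-∀

  ≋-trans : ∀ {x y z} → x ≋ y → y ≋ z → x ≋ z
  ≋-trans {x} {y} {z} (mod d) (mod e) = mod (subst (+ n ∣_) (eq x y z) (∣m∣n⇒∣m+n d e))
    where
    eq : ∀ x y z → (x - y) + (y - z) ≡ x - z
    eq = solve-∀

  ≋-+ : ∀ {x y x′ y′} → x ≋ y → x′ ≋ y′ → x + x′ ≋ y + y′
  ≋-+ {x} {y} {x′} {y′} (mod d) (mod e) = mod (subst (+ n ∣_) (eq x y x′ y′) (∣m∣n⇒∣m+n d e))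
    where
    eq : ∀ x y x′ y′ → (x - y) + (x′ - y′) ≡ (x + x′) - (y + y′)
    eq = solve-∀

  residue : ℤ → ℕ
  residue x = x %ℕ n

  residue≋ : ∀ x → x ≋ + residue x
  residue≋ x = mod (divides (x /ℕ n)
    (trans (cong (_- + residue x) (a≡a%ℕn+[a/ℕn]*n x n)) (eq (+ residue x) (x /ℕ n * + n))))
    where
    eq : ∀ r z → (r + z) - r ≡ z
    eq = solve-∀

  -- The difference is at most max(i, j) in absolute value, hence below n, and the only such
  -- multiple of n is 0.
  ≋⇒≡ : ∀ {i j} → i ℕ.< n → j ℕ.< n → + i ≋ + j → i ≡ j
  ≋⇒≡ {i} {j} i<n j<n (mod d) = ℤ.+-injective (ℤ.i-j≡0⇒i≡j (+ i) (+ j) (ℤ.∣i∣≡0⇒i≡0 abs≡0))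
    where
    abs<n : ∣ + i - + j ∣ ℕ.< n
    abs<n = ℕ.≤-<-trans (subst (λ z → ∣ z ∣ ℕ.≤ i ℕ.⊔ j) (sym (ℤ.m-n≡m⊖n i j)) (ℤ.∣m⊝n∣≤m⊔n i j))
      (ℕ.⊔-lub i<n j<n)
    abs≡0 : ∣ + i - + j ∣ ≡ 0
    abs≡0 with ∣ + i - + j ∣ | abs<n | ∣⇒∣ᵤ d
    ... | zero  | _  | _   = refl
    ... | suc _ | lt | n∣s = contradiction (ℕ.∣⇒≤ n∣s) (ℕ.<⇒≱ lt)

  value : Vec ℤ 5 → ℤ
  value a = dot a (tabulate g)

  -- The increments of a walk, added up as an unreduced integer; the vertices along the way are
  -- reduced modulo n only in `toWalk`.
  data SignedSum : ℕ → ℤ → Set where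
    nil : SignedSum 0 (+ 0)
    add : ∀ {ℓ r} → SignedSum ℓ r → ∀ t → SignedSum (suc ℓ) (g t + r)
    sub : ∀ {ℓ r} → SignedSum ℓ r → ∀ t → SignedSum (suc ℓ) (- g t + r)

  repeat : ∀ {ℓ r} → SignedSum ℓ r → ∀ t a → SignedSum (∣ a ∣ ℕ.+ ℓ) (a * g t + r)
  repeat {ℓ} {r} s t (+ zero)      = subst (SignedSum ℓ) (sym (ℤ.+-identityˡ r)) s
  repeat {ℓ} {r} s t (+ suc a)     =
    subst (SignedSum _) (eq (g t) (+ a) r) (add (repeat s t (+ a)) t)
    where
    eq : ∀ x a r → x + (a * x + r) ≡ (+ 1 + a) * x + r
    eq = solve-∀
  repeat {ℓ} {r} s t -[1+ zero ]   = subst (SignedSum _) (cong (_+ r) (sym (ℤ.-1*i≡-i (g t)))) (sub s t)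
  repeat {ℓ} {r} s t -[1+ suc a ]  =
    subst (SignedSum _) (eq (g t) -[1+ a ] r) (sub (repeat s t -[1+ a ]) t)
    where
    eq : ∀ x a r → - x + (a * x + r) ≡ (- + 1 + a) * x + r
    eq = solve-∀

  -- The map `h` lets the induction pass to the tail of the tuple of generators.
  signedSum : ∀ {p} (a : Vec ℤ p) (h : Fin p → Fin 5) → SignedSum (norm a) (dot a (tabulate (g ∘ h)))
  signedSum []       h = nil
  signedSum (a ∷ as) h = repeat (signedSum as (h ∘ suc)) (h zero) a

  -- The outermost term of the sum becomes the last step, so the recursion runs backwards from `j`:
  -- the preceding vertex is the residue of `j` minus that term.
  toWalk : ∀ {ℓ r i j} → SignedSum ℓ r → i ℕ.< n → j ℕ.< n → + j ≋ + i + r → Walk n g ℓ i j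
  toWalk {i = i} {j} nil i<n j<n d
    with refl ← ≋⇒≡ j<n i<n (subst (+ j ≋_) (ℤ.+-identityʳ (+ i)) d) = here i<n
  toWalk {i = i} {j} (add {r = r} s t) i<n j<n (mod d) =
    step (toWalk s i<n (n%ℕd<d x n) (≋-trans (≋-sym (residue≋ x)) (mod (subst (+ n ∣_) (eq (+ j) (+ i) (g t) r) d))))
      j<n (t , inj₁ (∣⇒∣ᵤ (subst (+ n ∣_) (eq′ (+ j) (g t) (+ residue x)) (_≋_.n∣x-y (residue≋ x)))))
    where
    x = + j - g t
    eq : ∀ j i g r → j - (i + (g + r)) ≡ (j - g) - (i + r)
    eq = solve-∀
    eq′ : ∀ j g y → (j - g) - y ≡ (j - y) - g
    eq′ = solve-∀
  toWalk {i = i} {j} (sub {r = r} s t) i<n j<n (mod d) =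
    step (toWalk s i<n (n%ℕd<d x n) (≋-trans (≋-sym (residue≋ x)) (mod (subst (+ n ∣_) (eq (+ j) (+ i) (g t) r) d))))
      j<n (t , inj₂ (∣⇒∣ᵤ (subst (+ n ∣_) (eq′ (+ j) (g t) (+ residue x)) (_≋_.n∣x-y (residue≋ x)))))
    where
    x = + j + g t
    eq : ∀ j i g r → j - (i + (- g + r)) ≡ (j + g) - (i + r)
    eq = solve-∀
    eq′ : ∀ j g y → (j + g) - y ≡ (j - y) + g
    eq′ = solve-∀

  -- The vector counts the steps along each generator with signs. Opposite steps cancel, hence only
  -- an inequality for the norm.
  fromWalk : ∀ {ℓ i j} → Walk n g ℓ i j → ∃[ a ] norm a ℕ.≤ ℓ × (+ j - + i ≋ value a)
  fromWalk {i = i} (here _) =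
    zeros , z≤n , ≋-reflexive (trans (ℤ.+-inverseʳ (+ i)) (sym (dot-zeros (tabulate g))))
  fromWalk {i = i} (step {ℓ} {j = j} {l} w _ (t , adj)) with fromWalk w
  ... | a , a≤ℓ , mod d = extend adj
    where
    norm≤ : ∀ s → ∣ s ∣ ≡ 1 → norm (unit s t ⊕ a) ℕ.≤ suc ℓ
    norm≤ s ∣s∣≡1 = ℕ.≤-trans (norm-⊕ (unit s t) a)
      (ℕ.+-mono-≤ (ℕ.≤-reflexive (trans (norm-unit s t) ∣s∣≡1)) a≤ℓ)
    value≡ : ∀ s → value (unit s t ⊕ a) ≡ s * g t + value a
    value≡ s = trans (dot-⊕ (unit s t) a (tabulate g)) (cong (_+ value a) (dot-unit s t g))
    eq₊ : ∀ l j i x v → ((l - j) - x) + ((j - i) - v) ≡ (l - i) - (+ 1 * x + v)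
    eq₊ = solve-∀
    eq₋ : ∀ l j i x v → ((l - j) + x) + ((j - i) - v) ≡ (l - i) - (- + 1 * x + v)
    eq₋ = solve-∀
    extend : _ → ∃[ b ] norm b ℕ.≤ suc ℓ × (+ l - + i ≋ value b)
    extend (inj₁ e) = unit (+ 1) t ⊕ a , norm≤ (+ 1) refl ,
      subst (_ ≋_) (sym (value≡ (+ 1)))
        (mod (subst (+ n ∣_) (eq₊ (+ l) (+ j) (+ i) (g t) (value a)) (∣m∣n⇒∣m+n (∣ᵤ⇒∣ {i = + l - + j - g t} e) d)))
    extend (inj₂ e) = unit (- + 1) t ⊕ a , norm≤ (- + 1) refl ,
      subst (_ ≋_) (sym (value≡ (- + 1)))
        (mod (subst (+ n ∣_) (eq₋ (+ l) (+ j) (+ i) (g t) (value a)) (∣m∣n⇒∣m+n (∣ᵤ⇒∣ {i = + l - + j + g t} e) d)))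

  adj? : ∀ i j → Dec (Adj n g i j)
  adj? i j = Fin.any? λ t → (n ℕ.∣? _) ⊎-dec (n ℕ.∣? _)

  walk? : ∀ ℓ i j → Dec (Walk n g ℓ i j)
  walk? zero i j = map′ (λ { (refl , i<n) → here i<n }) (λ { (here i<n) → refl , i<n })
    (i ℕ.≟ j ×-dec i ℕ.<? n)
  walk? (suc ℓ) i l = map′
    (λ { (l<n , j , _ , w , a) → step w l<n a })
    (λ { (step w l<n a) → l<n , _ , end< w , w , a })
    (l ℕ.<? n ×-dec ℕ.anyUpTo? (λ j → walk? ℓ i j ×-dec adj? j l) n)
    where
    end< : ∀ {ℓ i j} → Walk n g ℓ i j → j ℕ.< n
    end< (here j<n)     = j<n
    end< (step _ j<n _) = j<n

  -- Existence of a walk of given length is decidable, so a walk can be replaced by shorter ones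
  -- until none is left.
  shortest : ∀ {i j} ℓ → Walk n g ℓ i j → ∃[ e ] Dist n g i j e × e ℕ.≤ ℓ
  shortest {i} {j} = <-rec _ λ ℓ rec w → case ℓ rec w (ℕ.anyUpTo? (λ e → walk? e i j) ℓ)
    where
    case : ∀ ℓ → (∀ {e} → e ℕ.< ℓ → Walk n g e i j → ∃[ d ] Dist n g i j d × d ℕ.≤ e) →
      Walk n g ℓ i j → Dec (∃[ e ] e ℕ.< ℓ × Walk n g e i j) → ∃[ d ] Dist n g i j d × d ℕ.≤ ℓ
    case ℓ rec w (yes (e , e<ℓ , v)) with rec e<ℓ v
    ... | d , dist , d≤e = d , dist , ℕ.≤-trans d≤e (ℕ.<⇒≤ e<ℓ)
    case ℓ rec w (no ¬shorter) =
      ℓ , (w , λ e v → ℕ.≮⇒≥ λ e<ℓ → ¬shorter (e , e<ℓ , v)) , ℕ.≤-refl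

  Within : ℕ → ℤ → Set
  Within k r = ∃[ a ] norm a ℕ.≤ k × (r ≋ value a)

  -- By `far`, every walk from 0 to the residue of `r` has length at least `k`; by `near`, some walk
  -- has length at most `k`. This pair therefore attains the diameter.
  diameter : ∀ k → (∀ r → Within k r) → ∀ r → (∀ a → r ≋ value a → k ℕ.≤ norm a) → Diameter n g k
  diameter k near r far = upper , 0 , residue r , 0<n , r<n , attained
    where
    0<n = ℕ.>-nonZero⁻¹ n
    r<n = n%ℕd<d r n
    upper : ∀ i j → i ℕ.< n → j ℕ.< n → Σ ℕ λ e → Dist n g i j e × e ℕ.≤ k
    upper i j i<n j<n with near (+ j - + i)
    ... | a , a≤k , mod d with shortest (norm a) (toWalk (signedSum a (λ t → t)) i<n j<n
                            (mod (subst (+ n ∣_) (eq (+ j) (+ i) (value a)) d)))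
      where
      eq : ∀ j i v → (j - i) - v ≡ j - (i + v)
      eq = solve-∀
    ... | e , dist , e≤a = e , dist , ℕ.≤-trans e≤a a≤k
    far′ : ∀ e → Walk n g e 0 (residue r) → k ℕ.≤ e
    far′ e w with fromWalk w
    ... | a , a≤e , d = ℕ.≤-trans (far a (≋-trans (residue≋ r) (subst (_≋ value a) (ℤ.+-identityʳ _) d))) a≤e
    attained : Dist n g 0 (residue r) k
    attained with upper 0 (residue r) 0<n r<n
    ... | e , (w , min) , e≤k with ℕ.≤-antisym e≤k (far′ e w)
    ... | refl = w , far′

-- Integer polynomials as coefficient lists, lowest degree first, with tests for identity and
-- inequality.

Poly : Set
Poly = List ℤ

⟦_⟧ : Poly → ℤ → ℤ
⟦ []    ⟧ x = + 0
⟦ c ∷ p ⟧ x = c + x * ⟦ p ⟧ x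

infixl 6 _+ᴾ_ _-ᴾ_
infixl 7 _*ᴾ_ _·ᴾ_
_+ᴾ_ : Poly → Poly → Poly
[]      +ᴾ q       = q
(c ∷ p) +ᴾ []      = c ∷ p
(c ∷ p) +ᴾ (d ∷ q) = c + d ∷ p +ᴾ q

_·ᴾ_ : ℤ → Poly → Poly
c ·ᴾ p = List.map (c *_) p

-ᴾ_ : Poly → Poly
-ᴾ p = List.map -_ p

_-ᴾ_ : Poly → Poly → Poly
p -ᴾ q = p +ᴾ (-ᴾ q)

_*ᴾ_ : Poly → Poly → Poly
[]      *ᴾ q = []
(c ∷ p) *ᴾ q = c ·ᴾ q +ᴾ (+ 0 ∷ p *ᴾ q)

⟦⟧-+ : ∀ p q x → ⟦ p +ᴾ q ⟧ x ≡ ⟦ p ⟧ x + ⟦ q ⟧ x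
⟦⟧-+ []      q       x = sym (ℤ.+-identityˡ _)
⟦⟧-+ (c ∷ p) []      x = sym (ℤ.+-identityʳ _)
⟦⟧-+ (c ∷ p) (d ∷ q) x rewrite ⟦⟧-+ p q x = eq c d x (⟦ p ⟧ x) (⟦ q ⟧ x)
  where
  eq : ∀ c d x s t → c + d + x * (s + t) ≡ (c + x * s) + (d + x * t)
  eq = solve-∀

⟦⟧-· : ∀ c p x → ⟦ c ·ᴾ p ⟧ x ≡ c * ⟦ p ⟧ x
⟦⟧-· c []      x = sym (ℤ.*-zeroʳ c)
⟦⟧-· c (d ∷ p) x rewrite ⟦⟧-· c p x = eq c d x (⟦ p ⟧ x)
  where
  eq : ∀ c d x s → c * d + x * (c * s) ≡ c * (d + x * s)
  eq = solve-∀

⟦⟧-neg : ∀ p x → ⟦ -ᴾ p ⟧ x ≡ - ⟦ p ⟧ x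
⟦⟧-neg []      x = refl
⟦⟧-neg (d ∷ p) x rewrite ⟦⟧-neg p x = eq d x (⟦ p ⟧ x)
  where
  eq : ∀ d x s → - d + x * (- s) ≡ - (d + x * s)
  eq = solve-∀

⟦⟧-- : ∀ p q x → ⟦ p -ᴾ q ⟧ x ≡ ⟦ p ⟧ x - ⟦ q ⟧ x
⟦⟧-- p q x = trans (⟦⟧-+ p (-ᴾ q) x) (cong (λ y → ⟦ p ⟧ x + y) (⟦⟧-neg q x))

⟦⟧-* : ∀ p q x → ⟦ p *ᴾ q ⟧ x ≡ ⟦ p ⟧ x * ⟦ q ⟧ x
⟦⟧-* []      q x = refl
⟦⟧-* (c ∷ p) q x rewrite ⟦⟧-+ (c ·ᴾ q) (+ 0 ∷ p *ᴾ q) x | ⟦⟧-· c q x | ⟦⟧-* p q x =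
  eq c x (⟦ p ⟧ x) (⟦ q ⟧ x)
  where
  eq : ∀ c x s t → c * t + (+ 0 + x * (s * t)) ≡ (c + x * s) * t
  eq = solve-∀

isZero : Poly → Bool
isZero []      = true
isZero (c ∷ p) = (c ≤ᵇ + 0) ∧ (+ 0 ≤ᵇ c) ∧ isZero p

isZero-sound : ∀ p x → T (isZero p) → ⟦ p ⟧ x ≡ + 0
isZero-sound []      x _ = refl
isZero-sound (c ∷ p) x h with to (T-∧ {c ≤ᵇ + 0}) h
... | c≤0 , h′ with to (T-∧ {+ 0 ≤ᵇ c}) h′
... | 0≤c , p≡0 rewrite ℤ.≤-antisym (ℤ.≤ᵇ⇒≤ {c} c≤0) (ℤ.≤ᵇ⇒≤ {+ 0} 0≤c) | isZero-sound p x p≡0 =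
  trans (ℤ.+-identityˡ _) (ℤ.*-zeroʳ x)

-- Testing the difference, rather than the lists themselves, disregards trailing zeros.
_≈ᵇ_ : Poly → Poly → Bool
p ≈ᵇ q = isZero (p -ᴾ q)

≈ᵇ-sound : ∀ p q x → T (p ≈ᵇ q) → ⟦ p ⟧ x ≡ ⟦ q ⟧ x
≈ᵇ-sound p q x h = ℤ.i-j≡0⇒i≡j _ _ (trans (sym (⟦⟧-- p q x)) (isZero-sound (p -ᴾ q) x h))

-- For x ≥ 1, the value c + x p(x) is nonnegative as soon as p(x) and c + p(x) are.
nonNegative : ℤ → Poly → Bool
nonNegative c []      = + 0 ≤ᵇ c
nonNegative c (d ∷ p) = nonNegative d p ∧ nonNegative (c + d) p

nonNegative-sound : ∀ c p {x} → + 1 ≤ x → T (nonNegative c p) → + 0 ≤ ⟦ c ∷ p ⟧ x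
nonNegative-sound c []      {x} 1≤x h = subst (+ 0 ≤_)
  (trans (sym (ℤ.+-identityʳ c)) (cong (λ y → c + y) (sym (ℤ.*-zeroʳ x)))) (ℤ.≤ᵇ⇒≤ h)
nonNegative-sound c (d ∷ p) {x} 1≤x h with to (T-∧ {nonNegative d p}) h
... | h₁ , h₂ = begin
  + 0                                 ≤⟨ nonNegative-sound (c + d) p 1≤x h₂ ⟩
  (c + d) + x * ⟦ p ⟧ x               ≡⟨ ℤ.+-assoc c d _ ⟩
  c + ⟦ d ∷ p ⟧ x                     ≡⟨ cong (λ y → c + y) (ℤ.*-identityˡ (⟦ d ∷ p ⟧ x)) ⟨
  c + + 1 * ⟦ d ∷ p ⟧ x               ≤⟨ ℤ.+-monoʳ-≤ c (ℤ.*-monoʳ-≤-nonNeg (⟦ d ∷ p ⟧ x) 1≤x) ⟩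
  c + x * ⟦ d ∷ p ⟧ x                 ∎
  where
  open ℤ.≤-Reasoning
  instance nn = ℤ.nonNegative (nonNegative-sound d p 1≤x h₁)

nonNegativeᴾ : Poly → Bool
nonNegativeᴾ []      = true
nonNegativeᴾ (c ∷ p) = nonNegative c p

_≤ᴾ_ : Poly → Poly → Bool
p ≤ᴾ q = nonNegativeᴾ (q -ᴾ p)

≤ᴾ-sound : ∀ p q {x} → + 1 ≤ x → T (p ≤ᴾ q) → ⟦ p ⟧ x ≤ ⟦ q ⟧ x
≤ᴾ-sound p q {x} 1≤x h = ℤ.0≤i-j⇒j≤i (subst (+ 0 ≤_) (⟦⟧-- q p x) (value≥0 (q -ᴾ p) h))
  where
  value≥0 : ∀ r → T (nonNegativeᴾ r) → + 0 ≤ ⟦ r ⟧ x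
  value≥0 []      _ = ℤ.≤-refl
  value≥0 (c ∷ r) h = nonNegative-sound c r 1≤x h

-- Exactness of the divisions in the order and in the generators.

data Expr : Set where
  con           : ℕ → Expr
  var           : Expr
  _:+_ _:-_ _:*_ : Expr → Expr → Expr
infixl 6 _:+_ _:-_
infixl 7 _:*_

evaluate : Expr → ℤ → ℤ
evaluate (con c)  x = + c
evaluate var      x = x
evaluate (e :+ f) x = evaluate e x + evaluate f x
evaluate (e :- f) x = evaluate e x - evaluate f x
evaluate (e :* f) x = evaluate e x * evaluate f x

expand : Poly → Expr → Poly
expand k (con c)  = + c ∷ []
expand k var      = k
expand k (e :+ f) = expand k e +ᴾ expand k f
expand k (e :- f) = expand k e -ᴾ expand k f
expand k (e :* f) = expand k e *ᴾ expand k f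

⟦expand⟧ : ∀ k e x → ⟦ expand k e ⟧ x ≡ evaluate e (⟦ k ⟧ x)
⟦expand⟧ k (con c)  x = trans (cong (λ y → + c + y) (ℤ.*-zeroʳ x)) (ℤ.+-identityʳ (+ c))
⟦expand⟧ k var      x = refl
⟦expand⟧ k (e :+ f) x = trans (⟦⟧-+ (expand k e) (expand k f) x) (cong₂ _+_ (⟦expand⟧ k e x) (⟦expand⟧ k f x))
⟦expand⟧ k (e :- f) x = trans (⟦⟧-- (expand k e) (expand k f) x) (cong₂ _-_ (⟦expand⟧ k e x) (⟦expand⟧ k f x))
⟦expand⟧ k (e :* f) x = trans (⟦⟧-* (expand k e) (expand k f) x) (cong₂ _*_ (⟦expand⟧ k e x) (⟦expand⟧ k f x))

horner : List ℕ → ℕ → ℕ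
horner []       m = 0
horner (c ∷ cs) m = c ℕ.+ m ℕ.* horner cs m

pos-horner : ∀ cs m → + horner cs m ≡ ⟦ List.map +_ cs ⟧ (+ m)
pos-horner []       m = refl
pos-horner (c ∷ cs) m = trans (ℤ.pos-+ c _)
  (cong (λ y → + c + y) (trans (ℤ.pos-* m _) (cong (λ y → + m * y) (pos-horner cs m))))

diameterOf : ℕ → ℕ
diameterOf m = 15 ℕ.* m ℕ.+ 2

kᴾ : Poly
kᴾ = + 2 ∷ + 15 ∷ []

⟦kᴾ⟧ : ∀ m → ⟦ kᴾ ⟧ (+ m) ≡ + diameterOf m
⟦kᴾ⟧ m = trans (eq (+ m)) (trans (cong (_+ + 2) (sym (ℤ.pos-* 15 m))) (sym (ℤ.pos-+ (15 ℕ.* m) 2)))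
  where
  eq : ∀ x → + 2 + x * (+ 15 + x * + 0) ≡ + 15 * x + + 2
  eq = solve-∀

-- Substituting k = 15m + 2 turns the numerator into `d` times a polynomial in m with natural
-- coefficients `cs`. This is an identity of polynomials, so one evaluation settles it for all m.
exact : ∀ e d .{{_ : ℕ.NonZero d}} cs → T (expand kᴾ e ≈ᵇ (+ d ·ᴾ List.map +_ cs)) →
  ∀ m → evaluate e (+ diameterOf m) /ℕ d ≡ + horner cs m
exact e d cs h m = begin
  evaluate e (+ diameterOf m) /ℕ d        ≡⟨ cong (λ y → evaluate e y /ℕ d) (⟦kᴾ⟧ m) ⟨
  evaluate e (⟦ kᴾ ⟧ (+ m)) /ℕ d          ≡⟨ cong (_/ℕ d) (⟦expand⟧ kᴾ e (+ m)) ⟨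
  ⟦ expand kᴾ e ⟧ (+ m) /ℕ d              ≡⟨ cong (_/ℕ d) (≈ᵇ-sound (expand kᴾ e) _ (+ m) h) ⟩
  ⟦ + d ·ᴾ List.map +_ cs ⟧ (+ m) /ℕ d    ≡⟨ cong (_/ℕ d) (⟦⟧-· (+ d) (List.map +_ cs) (+ m)) ⟩
  (+ d * ⟦ List.map +_ cs ⟧ (+ m)) /ℕ d   ≡⟨ cong (λ y → (+ d * y) /ℕ d) (pos-horner cs m) ⟨
  (+ d * + horner cs m) /ℕ d              ≡⟨ cong (_/ℕ d) (ℤ.*-comm (+ d) (+ horner cs m)) ⟩
  (+ horner cs m * + d) /ℕ d              ≡⟨ cong (_/ℕ d) (ℤ.pos-* (horner cs m) d) ⟨
  + (horner cs m ℕ.* d) /ℕ d              ≡⟨ cong +_ (m*n/n≡m (horner cs m) d) ⟩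
  + horner cs m                           ∎
  where open ≡-Reasoning

-- The quotients expanded in powers of m. At m = 0 the order is 45 and the generators are 1, 19, 3,
-- 5, 12.
orderCoeffs : List ℕ
orderCoeffs = 45 ∷ 942 ∷ 8352 ∷ 39744 ∷ 103680 ∷ 124416 ∷ []

genCoeffs : Fin 5 → List ℕ
genCoeffs 0F = 1 ∷ []
genCoeffs 1F = 19 ∷ 312 ∷ 2088 ∷ 6912 ∷ 10368 ∷ []
genCoeffs 2F = 3 ∷ 156 ∷ 1896 ∷ 10656 ∷ 31104 ∷ 41472 ∷ []
genCoeffs 3F = 5 ∷ 168 ∷ 1896 ∷ 10656 ∷ 31104 ∷ 41472 ∷ []
genCoeffs 4F = 12 ∷ 258 ∷ 2328 ∷ 11520 ∷ 31104 ∷ 41472 ∷ []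

order : ℕ → ℕ
order = horner orderCoeffs

-- The products associate to the left as in the definitions of `LCC10` and `gen`, so that `evaluate`
-- unfolds to exactly those numerators.
k² k³ k⁴ k⁵ : Expr
k² = var :* var
k³ = k² :* var
k⁴ = k³ :* var
k⁵ = k⁴ :* var

LCC10≡order : ∀ m → LCC10 (diameterOf m) ≡ + order m
LCC10≡order = exact (con 512 :* k⁵ :+ con 1280 :* k⁴ :+ con 6080 :* k³ :+ con 7840 :* k² :+ con 10010 :* var :+ con 3741)
  3125 orderCoeffs tt

gen≡ : ∀ m t → gen (diameterOf m) t ≡ + horner (genCoeffs t) m
gen≡ m 0F = cong (λ z → + (1 ℕ.+ z)) (sym (ℕ.*-zeroʳ m))
gen≡ m 1F = exact (con 128 :* k⁴ :+ con 256 :* k³ :+ con 1192 :* k² :+ con 1064 :* var :+ con 883)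
  625 (genCoeffs 1F) tt m
gen≡ m 2F = exact (con 512 :* k⁵ :+ con 640 :* k⁴ :+ con 4000 :* k³ :- con 1320 :* k² :- con 6660 :* var :- con 11899)
  9375 (genCoeffs 2F) tt m
gen≡ m 3F = exact (con 512 :* k⁵ :+ con 640 :* k⁴ :+ con 4000 :* k³ :- con 1320 :* k² :+ con 840 :* var :- con 8149)
  9375 (genCoeffs 3F) tt m
gen≡ m 4F = exact (con 512 :* k⁵ :+ con 640 :* k⁴ :+ con 6400 :* k³ :+ con 2280 :* k² :+ con 13890 :* var :- con 2224)
  9375 (genCoeffs 4F) tt m

-- Integer combinations of vectors, and vectors of polynomials.

scale : ℤ → Vec ℤ p → Vec ℤ p
scale c = map (c *_)

comb : Vec ℤ r → Vec (Vec ℤ p) r → Vec ℤ p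
comb []       []       = zeros
comb (c ∷ cs) (b ∷ bs) = scale c b ⊕ comb cs bs

⊕-identityˡ : (a : Vec ℤ p) → zeros ⊕ a ≡ a
⊕-identityˡ []       = refl
⊕-identityˡ (a ∷ as) = cong₂ _∷_ (ℤ.+-identityˡ a) (⊕-identityˡ as)

⊕-identityʳ : (a : Vec ℤ p) → a ⊕ zeros ≡ a
⊕-identityʳ []       = refl
⊕-identityʳ (a ∷ as) = cong₂ _∷_ (ℤ.+-identityʳ a) (⊕-identityʳ as)

⊕-interchange : (a b c d : Vec ℤ p) → (a ⊕ b) ⊕ (c ⊕ d) ≡ (a ⊕ c) ⊕ (b ⊕ d)
⊕-interchange []       []       []       []       = refl
⊕-interchange (a ∷ as) (b ∷ bs) (c ∷ cs) (d ∷ ds) =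
  cong₂ _∷_ (eq a b c d) (⊕-interchange as bs cs ds)
  where
  eq : ∀ a b c d → (a + b) + (c + d) ≡ (a + c) + (b + d)
  eq = solve-∀

scale-zeros : ∀ c → scale c (zeros {p}) ≡ zeros
scale-zeros {zero}  c = refl
scale-zeros {suc p} c = cong₂ _∷_ (ℤ.*-zeroʳ c) (scale-zeros c)

scale-⊕ : ∀ c (a b : Vec ℤ p) → scale c (a ⊕ b) ≡ scale c a ⊕ scale c b
scale-⊕ c []       []       = refl
scale-⊕ c (a ∷ as) (b ∷ bs) = cong₂ _∷_ (ℤ.*-distribˡ-+ c a b) (scale-⊕ c as bs)

scale-+ : ∀ c d (a : Vec ℤ p) → scale (c + d) a ≡ scale c a ⊕ scale d a
scale-+ c d []       = refl
scale-+ c d (a ∷ as) = cong₂ _∷_ (ℤ.*-distribʳ-+ a c d) (scale-+ c d as)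

scale-* : ∀ c d (a : Vec ℤ p) → scale (c * d) a ≡ scale c (scale d a)
scale-* c d []       = refl
scale-* c d (a ∷ as) = cong₂ _∷_ (ℤ.*-assoc c d a) (scale-* c d as)

scale-0 : (a : Vec ℤ p) → scale (+ 0) a ≡ zeros
scale-0 []       = refl
scale-0 (a ∷ as) = cong₂ _∷_ refl (scale-0 as)

comb-⊕ : (c d : Vec ℤ r) (bs : Vec (Vec ℤ p) r) → comb (c ⊕ d) bs ≡ comb c bs ⊕ comb d bs
comb-⊕ []       []       []       = sym (⊕-identityˡ zeros)
comb-⊕ (c ∷ cs) (d ∷ ds) (b ∷ bs) = trans
  (cong₂ _⊕_ (scale-+ c d b) (comb-⊕ cs ds bs))
  (⊕-interchange (scale c b) (scale d b) (comb cs bs) (comb ds bs))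

comb-scale : ∀ c (ds : Vec ℤ r) (bs : Vec (Vec ℤ p) r) → comb (scale c ds) bs ≡ scale c (comb ds bs)
comb-scale c []       []       = sym (scale-zeros c)
comb-scale c (d ∷ ds) (b ∷ bs) = trans
  (cong₂ _⊕_ (scale-* c d b) (comb-scale c ds bs))
  (sym (scale-⊕ c (scale d b) (comb ds bs)))

comb-zeros : (bs : Vec (Vec ℤ p) r) → comb zeros bs ≡ zeros
comb-zeros []       = refl
comb-zeros (b ∷ bs) = trans (cong₂ _⊕_ (scale-0 b) (comb-zeros bs)) (⊕-identityˡ zeros)

-- Associativity of the matrix product; it rewrites a combination of `relations` as one of `basis`.
comb-comb : (c : Vec ℤ s) (ds : Vec (Vec ℤ r) s) (bs : Vec (Vec ℤ p) r) →
  comb c (map (λ d → comb d bs) ds) ≡ comb (comb c ds) bs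
comb-comb []       []       bs = sym (comb-zeros bs)
comb-comb (c ∷ cs) (d ∷ ds) bs = trans
  (cong₂ _⊕_ (sym (comb-scale c d bs)) (comb-comb cs ds bs))
  (sym (comb-⊕ (scale c d) (comb cs ds) bs))

units : ℤ → Vec (Vec ℤ p) p
units c = tabulate (unit c)

comb-cons-0 : (e : Vec ℤ r) (f : Fin r → Vec ℤ p) → comb e (tabulate (λ i → + 0 ∷ f i)) ≡ + 0 ∷ comb e (tabulate f)
comb-cons-0 []       f = refl
comb-cons-0 (e ∷ es) f rewrite comb-cons-0 es (f ∘ suc) | ℤ.*-zeroʳ e = refl

comb-units : ∀ c (e : Vec ℤ p) → comb e (units c) ≡ scale c e
comb-units c []       = refl
comb-units c (e ∷ es) = trans (cong (scale e (c ∷ zeros) ⊕_) (comb-cons-0 es (unit c)))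
  (cong₂ _∷_ (trans (ℤ.+-identityʳ (e * c)) (ℤ.*-comm e c))
    (trans (cong₂ _⊕_ (scale-zeros e) (comb-units c es)) (⊕-identityˡ (scale c es))))

dot-scale : ∀ c (a b : Vec ℤ p) → dot (scale c a) b ≡ c * dot a b
dot-scale c []       []       = sym (ℤ.*-zeroʳ c)
dot-scale c (a ∷ as) (b ∷ bs) rewrite dot-scale c as bs = eq c a b (dot as bs)
  where
  eq : ∀ c a b s → c * a * b + c * s ≡ c * (a * b + s)
  eq = solve-∀

∣dot-comb : ∀ {n} (g : Vec ℤ p) (c : Vec ℤ r) {bs} → All (λ b → n ∣ dot b g) bs → n ∣ dot (comb c bs) g
∣dot-comb {n = n} g [] [] = subst (n ∣_) (sym (dot-zeros g)) (divides (+ 0) refl)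
∣dot-comb {n = n} g (c ∷ cs) {b ∷ bs} (n∣b ∷ n∣bs) = subst (n ∣_)
  (sym (trans (dot-⊕ (scale c b) (comb cs bs) g) (cong (_+ dot (comb cs bs) g) (dot-scale c b g))))
  (∣m∣n⇒∣m+n (∣n⇒∣m*n c n∣b) (∣dot-comb g cs n∣bs))

at : ℤ → Vec Poly p → Vec ℤ p
at x = map λ q → ⟦ q ⟧ x

dotᴾ : Vec Poly p → Vec Poly p → Poly
dotᴾ []       []       = []
dotᴾ (a ∷ as) (b ∷ bs) = a *ᴾ b +ᴾ dotᴾ as bs

⟦dotᴾ⟧ : ∀ (a b : Vec Poly p) x → ⟦ dotᴾ a b ⟧ x ≡ dot (at x a) (at x b)
⟦dotᴾ⟧ []       []       x = refl
⟦dotᴾ⟧ (a ∷ as) (b ∷ bs) x = trans (⟦⟧-+ (a *ᴾ b) (dotᴾ as bs) x)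
  (cong₂ _+_ (⟦⟧-* a b x) (⟦dotᴾ⟧ as bs x))

combᴾ : Vec Poly r → Vec (Vec Poly p) r → Vec Poly p
combᴾ []       []       = replicate _ []
combᴾ (c ∷ cs) (b ∷ bs) = zipWith _+ᴾ_ (map (c *ᴾ_) b) (combᴾ cs bs)

at-combᴾ : ∀ (c : Vec Poly r) (bs : Vec (Vec Poly p) r) x → at x (combᴾ c bs) ≡ comb (at x c) (map (at x) bs)
at-combᴾ []       []       x = Vec.map-replicate (λ q → ⟦ q ⟧ x) [] _
at-combᴾ (c ∷ cs) (b ∷ bs) x = trans (linear b (combᴾ cs bs)) (cong (scale (⟦ c ⟧ x) (at x b) ⊕_) (at-combᴾ cs bs x))
  where
  linear : ∀ {p} (b s : Vec Poly p) → at x (zipWith _+ᴾ_ (map (c *ᴾ_) b) s) ≡ scale (⟦ c ⟧ x) (at x b) ⊕ at x s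
  linear []       []       = refl
  linear (b ∷ bs) (s ∷ ss) = cong₂ _∷_
    (trans (⟦⟧-+ (c *ᴾ b) s x) (cong (_+ ⟦ s ⟧ x) (⟦⟧-* c b x))) (linear bs ss)

_≈ᵛ_ : Vec Poly p → Vec Poly p → Bool
[]       ≈ᵛ []       = true
(a ∷ as) ≈ᵛ (b ∷ bs) = (a ≈ᵇ b) ∧ (as ≈ᵛ bs)

≈ᵛ-sound : ∀ (a b : Vec Poly p) x → T (a ≈ᵛ b) → at x a ≡ at x b
≈ᵛ-sound []       []       x _ = refl
≈ᵛ-sound (a ∷ as) (b ∷ bs) x h with to (T-∧ {a ≈ᵇ b}) h
... | h₁ , h₂ = cong₂ _∷_ (≈ᵇ-sound a b x h₁) (≈ᵛ-sound as bs x h₂)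

-- The lattice of relations between the generators modulo n.

-- The matrix C. For a vector ε of signs, skew symmetry of C - 2I makes ε·Cε equal to the trace 10,
-- so for m ≥ 1 every corner has norm 30m + 5 = 2k + 1.
perturbation : Vec (Vec ℤ 5) 5
perturbation =
  (+ 2   ∷ + 0   ∷ + 1   ∷ - + 1 ∷ + 0   ∷ []) ∷
  (+ 0   ∷ + 2   ∷ + 0   ∷ - + 1 ∷ + 1   ∷ []) ∷
  (- + 1 ∷ + 0   ∷ + 2   ∷ - + 1 ∷ + 0   ∷ []) ∷
  (+ 1   ∷ + 1   ∷ + 1   ∷ + 2   ∷ + 1   ∷ []) ∷
  (+ 0   ∷ - + 1 ∷ + 0   ∷ - + 1 ∷ + 2   ∷ []) ∷ []

-- The rows of 12m I + C, as polynomials in m.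
edges : Vec (Vec Poly 5) 5
edges = zipWith (zipWith λ a b → a ∷ b ∷ []) perturbation (units (+ 12))

corner : Vec Poly 5
corner = (+ 1 ∷ + 6 ∷ []) ∷ (+ 1 ∷ + 6 ∷ []) ∷ (+ 2 ∷ + 6 ∷ []) ∷ (- + 1 ∷ + 6 ∷ []) ∷ (+ 2 ∷ + 6 ∷ []) ∷ []

-- A redundant generating system: twice the corner is the sum of the edges. Keeping all five edges
-- preserves the form 12m I + C.
basis : Vec (Vec Poly 5) 6
basis = corner ∷ edges

orderᴾ : Poly
orderᴾ = List.map +_ orderCoeffs

gensᴾ : Vec Poly 5
gensᴾ = tabulate (List.map +_ ∘ genCoeffs)

at-gensᴾ : ∀ m → at (+ m) gensᴾ ≡ tabulate (gen (diameterOf m))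
at-gensᴾ m = trans (sym (Vec.tabulate-∘ (λ q → ⟦ q ⟧ (+ m)) (List.map +_ ∘ genCoeffs)))
  (Vec.tabulate-cong λ t → trans (sym (pos-horner (genCoeffs t) m)) (sym (gen≡ m t)))

multiples : Vec (Vec Poly 5) r → Vec Poly r → Bool
multiples []       []       = true
multiples (b ∷ bs) (q ∷ qs) = (dotᴾ b gensᴾ ≈ᵇ (q *ᴾ orderᴾ)) ∧ multiples bs qs

multiples-sound : ∀ (bs : Vec (Vec Poly 5) r) qs x {g n} → at x gensᴾ ≡ g → ⟦ orderᴾ ⟧ x ≡ n →
  T (multiples bs qs) → All (λ b → n ∣ dot b g) (map (at x) bs)
multiples-sound []       []       x _    _    _ = []
multiples-sound (b ∷ bs) (q ∷ qs) x refl refl h with to (T-∧ {dotᴾ b gensᴾ ≈ᵇ (q *ᴾ orderᴾ)}) h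
... | h₁ , h₂ = divides (⟦ q ⟧ x) b·g≡ ∷ multiples-sound bs qs x refl refl h₂
  where
  open ≡-Reasoning
  b·g≡ : dot (at x b) (at x gensᴾ) ≡ ⟦ q ⟧ x * ⟦ orderᴾ ⟧ x
  b·g≡ = begin
    dot (at x b) (at x gensᴾ)    ≡⟨ ⟦dotᴾ⟧ b gensᴾ x ⟨
    ⟦ dotᴾ b gensᴾ ⟧ x           ≡⟨ ≈ᵇ-sound (dotᴾ b gensᴾ) (q *ᴾ orderᴾ) x h₁ ⟩
    ⟦ q *ᴾ orderᴾ ⟧ x            ≡⟨ ⟦⟧-* q orderᴾ x ⟩
    ⟦ q ⟧ x * ⟦ orderᴾ ⟧ x       ∎

basis-relations : ∀ x {g n} → at x gensᴾ ≡ g → ⟦ orderᴾ ⟧ x ≡ n → All (λ b → n ∣ dot b g) (map (at x) basis)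
basis-relations x g≡ n≡ = multiples-sound basis
  -- The quotients of b·g by the order, one for each b in `basis`. As the edges sum to twice the
  -- corner, the last five add up to 2(1 + 6m).
  ((+ 1 ∷ + 6 ∷ []) ∷ [] ∷ (+ 1 ∷ []) ∷ (+ 0 ∷ + 4 ∷ []) ∷ (+ 1 ∷ + 4 ∷ []) ∷ (+ 0 ∷ + 4 ∷ []) ∷ []) x g≡ n≡ tt

-- n e₁ and eᵢ − gᵢ e₁ generate all a with a·g ≡ 0 (mod n).
relations : Vec (Vec Poly 5) 5
relations =
  (orderᴾ   ∷ []         ∷ []         ∷ []         ∷ []         ∷ []) ∷
  (neg 1F   ∷ (+ 1 ∷ []) ∷ []         ∷ []         ∷ []         ∷ []) ∷
  (neg 2F   ∷ []         ∷ (+ 1 ∷ []) ∷ []         ∷ []         ∷ []) ∷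
  (neg 3F   ∷ []         ∷ []         ∷ (+ 1 ∷ []) ∷ []         ∷ []) ∷
  (neg 4F   ∷ []         ∷ []         ∷ []         ∷ (+ 1 ∷ []) ∷ []) ∷ []
  where
  neg : Fin 5 → Poly
  neg t = -ᴾ List.map +_ (genCoeffs t)

-- The coordinates of these relations with respect to the basis.
dual : Vec (Vec Poly 6) 5
dual =
  ( (+ 1 ∷ [])
  ∷ (+ 16 ∷ + 288 ∷ + 2016 ∷ + 6912 ∷ + 10368 ∷ [])
  ∷ (- + 2 ∷ - + 24 ∷ - + 72 ∷ [])
  ∷ (- + 10 ∷ - + 114 ∷ - + 504 ∷ - + 864 ∷ [])
  ∷ (+ 2 ∷ + 54 ∷ + 360 ∷ + 864 ∷ [])
  ∷ (- + 1 ∷ - + 12 ∷ - + 72 ∷ []) ∷ []) ∷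
  ( []
  ∷ (- + 7 ∷ - + 90 ∷ - + 432 ∷ - + 864 ∷ [])
  ∷ (+ 1 ∷ + 6 ∷ [])
  ∷ (+ 4 ∷ + 30 ∷ + 72 ∷ [])
  ∷ (- + 1 ∷ - + 18 ∷ - + 72 ∷ [])
  ∷ (+ 0 ∷ + 6 ∷ []) ∷ []) ∷
  ( []
  ∷ (- + 1 ∷ - + 54 ∷ - + 504 ∷ - + 2016 ∷ - + 3456 ∷ [])
  ∷ (+ 0 ∷ + 6 ∷ + 24 ∷ [])
  ∷ (+ 1 ∷ + 26 ∷ + 144 ∷ + 288 ∷ [])
  ∷ (+ 0 ∷ - + 10 ∷ - + 96 ∷ - + 288 ∷ [])
  ∷ (+ 0 ∷ + 2 ∷ + 24 ∷ []) ∷ []) ∷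
  ( []
  ∷ (- + 2 ∷ - + 54 ∷ - + 504 ∷ - + 2016 ∷ - + 3456 ∷ [])
  ∷ (+ 0 ∷ + 6 ∷ + 24 ∷ [])
  ∷ (+ 1 ∷ + 26 ∷ + 144 ∷ + 288 ∷ [])
  ∷ (+ 0 ∷ - + 10 ∷ - + 96 ∷ - + 288 ∷ [])
  ∷ (+ 0 ∷ + 2 ∷ + 24 ∷ []) ∷ []) ∷
  ( (+ 1 ∷ [])
  ∷ (- + 5 ∷ - + 78 ∷ - + 576 ∷ - + 2016 ∷ - + 3456 ∷ [])
  ∷ (+ 0 ∷ + 6 ∷ + 24 ∷ [])
  ∷ (+ 2 ∷ + 32 ∷ + 144 ∷ + 288 ∷ [])
  ∷ (- + 1 ∷ - + 16 ∷ - + 96 ∷ - + 288 ∷ [])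
  ∷ (+ 0 ∷ + 2 ∷ + 24 ∷ []) ∷ []) ∷ []

rows≈ : Vec (Vec Poly p) r → Vec (Vec Poly p) r → Bool
rows≈ []       []       = true
rows≈ (a ∷ as) (b ∷ bs) = (a ≈ᵛ b) ∧ rows≈ as bs

rows≈-sound : ∀ (as bs : Vec (Vec Poly p) r) x → T (rows≈ as bs) → map (at x) as ≡ map (at x) bs
rows≈-sound []       []       x _ = refl
rows≈-sound (a ∷ as) (b ∷ bs) x h with to (T-∧ {a ≈ᵛ b}) h
... | h₁ , h₂ = cong₂ _∷_ (≈ᵛ-sound a b x h₁) (rows≈-sound as bs x h₂)

relations≡ : ∀ x → map (at x) relations ≡ map (λ d → comb d (map (at x) basis)) (map (at x) dual)
relations≡ x = begin
  map (at x) relations                                    ≡⟨ rows≈-sound relations (map (λ d → combᴾ d basis) dual) x tt ⟩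
  map (at x) (map (λ d → combᴾ d basis) dual)             ≡⟨ Vec.map-∘ (at x) (λ d → combᴾ d basis) dual ⟨
  map (λ d → at x (combᴾ d basis)) dual                   ≡⟨ Vec.map-cong (λ d → at-combᴾ d basis x) dual ⟩
  map (λ d → comb (at x d) (map (at x) basis)) dual       ≡⟨ Vec.map-∘ (λ d → comb d (map (at x) basis)) (at x) dual ⟩
  map (λ d → comb d (map (at x) basis)) (map (at x) dual) ∎
  where open ≡-Reasoning

-- The parameter `one` stands for the value of the constant polynomial 1, which is `+ 1 + x * + 0`
-- and, for a variable `x`, not definitionally `+ 1`.
relationMatrix : (one n g₂ g₃ g₄ g₅ : ℤ) → Vec (Vec ℤ 5) 5
relationMatrix one n g₂ g₃ g₄ g₅ =
  (n    ∷ + 0 ∷ + 0 ∷ + 0 ∷ + 0 ∷ []) ∷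
  (- g₂ ∷ one ∷ + 0 ∷ + 0 ∷ + 0 ∷ []) ∷
  (- g₃ ∷ + 0 ∷ one ∷ + 0 ∷ + 0 ∷ []) ∷
  (- g₄ ∷ + 0 ∷ + 0 ∷ one ∷ + 0 ∷ []) ∷
  (- g₅ ∷ + 0 ∷ + 0 ∷ + 0 ∷ one ∷ []) ∷ []

-- The coefficients are q for n e₁ and aᵢ for eᵢ - gᵢ e₁, i ≥ 2. Only the first coordinate uses the
-- hypothesis: there a₁ = a·g - (a₂g₂ + ⋯ + a₅g₅), and a·g = qn.
decompose : ∀ x q n a₁ a₂ a₃ a₄ a₅ g₂ g₃ g₄ g₅ → let one = + 1 + x * + 0 in
  dot (a₁ ∷ a₂ ∷ a₃ ∷ a₄ ∷ a₅ ∷ []) (one ∷ g₂ ∷ g₃ ∷ g₄ ∷ g₅ ∷ []) ≡ q * n →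
  a₁ ∷ a₂ ∷ a₃ ∷ a₄ ∷ a₅ ∷ [] ≡ comb (q ∷ a₂ ∷ a₃ ∷ a₄ ∷ a₅ ∷ []) (relationMatrix one n g₂ g₃ g₄ g₅)
decompose x q n a₁ a₂ a₃ a₄ a₅ g₂ g₃ g₄ g₅ a·g≡ =
  cong₂ _∷_ (trans (first x a₁ a₂ a₃ a₄ a₅ g₂ g₃ g₄ g₅) (cong (_+ _) a·g≡))
  (cong₂ _∷_ (second x q a₂ a₃ a₄ a₅)
  (cong₂ _∷_ (third x q a₂ a₃ a₄ a₅)
  (cong₂ _∷_ (fourth x q a₂ a₃ a₄ a₅)
  (cong₂ _∷_ (fifth x q a₂ a₃ a₄ a₅) refl))))
  where
  first : ∀ x a₁ a₂ a₃ a₄ a₅ g₂ g₃ g₄ g₅ → a₁ ≡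
    (a₁ * (+ 1 + x * + 0) + (a₂ * g₂ + (a₃ * g₃ + (a₄ * g₄ + (a₅ * g₅ + + 0))))) +
    (a₂ * - g₂ + (a₃ * - g₃ + (a₄ * - g₄ + (a₅ * - g₅ + + 0))))
  first = solve-∀
  second : ∀ x q a₂ a₃ a₄ a₅ → a₂ ≡
    q * + 0 + (a₂ * (+ 1 + x * + 0) + (a₃ * + 0 + (a₄ * + 0 + (a₅ * + 0 + + 0))))
  second = solve-∀
  third : ∀ x q a₂ a₃ a₄ a₅ → a₃ ≡
    q * + 0 + (a₂ * + 0 + (a₃ * (+ 1 + x * + 0) + (a₄ * + 0 + (a₅ * + 0 + + 0))))
  third = solve-∀
  fourth : ∀ x q a₂ a₃ a₄ a₅ → a₄ ≡
    q * + 0 + (a₂ * + 0 + (a₃ * + 0 + (a₄ * (+ 1 + x * + 0) + (a₅ * + 0 + + 0))))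
  fourth = solve-∀
  fifth : ∀ x q a₂ a₃ a₄ a₅ → a₅ ≡
    q * + 0 + (a₂ * + 0 + (a₃ * + 0 + (a₄ * + 0 + (a₅ * (+ 1 + x * + 0) + + 0))))
  fifth = solve-∀

-- The converse of `basis-relations`: no solution of a·g ≡ 0 lies outside the lattice. The lower
-- bound depends on it, as it concerns every vector of a class.
span : ∀ x a q → dot a (at x gensᴾ) ≡ q * ⟦ orderᴾ ⟧ x → ∃[ c ] a ≡ comb c (map (at x) basis)
span x a@(a₁ ∷ a₂ ∷ a₃ ∷ a₄ ∷ a₅ ∷ []) q a·g≡ = comb c (map (at x) dual) , (begin
  a                                                               ≡⟨ decompose x q (⟦ orderᴾ ⟧ x) a₁ a₂ a₃ a₄ a₅ (γ 1F) (γ 2F) (γ 3F) (γ 4F) a·g≡ ⟩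
  comb c matrix                                                   ≡⟨ cong (comb c) relations-at ⟨
  comb c (map (at x) relations)                                   ≡⟨ cong (comb c) (relations≡ x) ⟩
  comb c (map (λ d → comb d (map (at x) basis)) (map (at x) dual)) ≡⟨ comb-comb c (map (at x) dual) (map (at x) basis) ⟩
  comb (comb c (map (at x) dual)) (map (at x) basis)              ∎)
  where
  open ≡-Reasoning
  c = q ∷ a₂ ∷ a₃ ∷ a₄ ∷ a₅ ∷ []
  γ : Fin 5 → ℤ
  γ t = ⟦ List.map +_ (genCoeffs t) ⟧ x
  matrix = relationMatrix (+ 1 + x * + 0) (⟦ orderᴾ ⟧ x) (γ 1F) (γ 2F) (γ 3F) (γ 4F)
  relations-at : map (at x) relations ≡ matrix
  relations-at = cong₂ _∷_ refl
    (cong₂ _∷_ (cong₂ _∷_ (⟦⟧-neg (List.map +_ (genCoeffs 1F)) x) refl)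
    (cong₂ _∷_ (cong₂ _∷_ (⟦⟧-neg (List.map +_ (genCoeffs 2F)) x) refl)
    (cong₂ _∷_ (cong₂ _∷_ (⟦⟧-neg (List.map +_ (genCoeffs 3F)) x) refl)
    (cong₂ _∷_ (cong₂ _∷_ (⟦⟧-neg (List.map +_ (genCoeffs 4F)) x) refl) refl))))

-- Lower bound: a point of norm k that is shortest in its class.

cost : Vec ℤ r → Vec ℕ r → ℕ
cost []       []       = 0
cost (e ∷ es) (c ∷ cs) = ∣ e ∣ ℕ.* c ℕ.+ cost es cs

cost-+ : (e : Vec ℤ r) (c d : Vec ℕ r) → cost e (zipWith ℕ._+_ c d) ≡ cost e c ℕ.+ cost e d
cost-+ []       []       []       = refl
cost-+ (e ∷ es) (c ∷ cs) (d ∷ ds) rewrite cost-+ es cs ds = eq ∣ e ∣ c d (cost es cs) (cost es ds)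
  where
  eq : ∀ e c d s t → e ℕ.* (c ℕ.+ d) ℕ.+ (s ℕ.+ t) ≡ (e ℕ.* c ℕ.+ s) ℕ.+ (e ℕ.* d ℕ.+ t)
  eq = ℕ.solve-∀

cost-≤ : ∀ {b} (e : Vec ℤ r) {c} → All (ℕ._≤ b) c → cost e c ℕ.≤ b ℕ.* norm e
cost-≤ []           []           = z≤n
cost-≤ {b = b} (e ∷ es) {c ∷ cs} (c≤b ∷ cs≤b) = begin
  ∣ e ∣ ℕ.* c ℕ.+ cost es cs      ≤⟨ ℕ.+-mono-≤ (ℕ.*-monoʳ-≤ ∣ e ∣ c≤b) (cost-≤ es cs≤b) ⟩
  ∣ e ∣ ℕ.* b ℕ.+ b ℕ.* norm es   ≡⟨ cong (ℕ._+ b ℕ.* norm es) (ℕ.*-comm ∣ e ∣ b) ⟩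
  b ℕ.* ∣ e ∣ ℕ.+ b ℕ.* norm es   ≡⟨ ℕ.*-distribˡ-+ b ∣ e ∣ (norm es) ⟨
  b ℕ.* (∣ e ∣ ℕ.+ norm es)       ∎
  where open ℕ.≤-Reasoning

norm-scale : ∀ c (a : Vec ℤ p) → norm (scale c a) ≡ ∣ c ∣ ℕ.* norm a
norm-scale c []       = sym (ℕ.*-zeroʳ ∣ c ∣)
norm-scale c (a ∷ as) = trans (cong₂ ℕ._+_ (ℤ.abs-* c a) (norm-scale c as)) (sym (ℕ.*-distribˡ-+ ∣ c ∣ ∣ a ∣ (norm as)))

norm-comb : (e : Vec ℤ r) (bs : Vec (Vec ℤ p) r) → norm (comb e bs) ℕ.≤ cost e (map norm bs)
norm-comb {p = p} [] [] = ℕ.≤-reflexive (norm-zeros p)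
norm-comb (e ∷ es) (b ∷ bs) = ℕ.≤-trans (norm-⊕ (scale e b) (comb es bs))
  (ℕ.+-mono-≤ (ℕ.≤-reflexive (norm-scale e b)) (norm-comb es bs))

-- For e ≥ 0 nothing is lost. For e < 0 the loss is at most 2w, and ∣e∣ ≥ 1.
∣+∣-shift : ∀ w b e → w ℕ.+ b ℕ.* ∣ e ∣ ℕ.≤ ∣ + w + + b * e ∣ ℕ.+ ∣ e ∣ ℕ.* (2 ℕ.* w)
∣+∣-shift w b (+ q) = ℕ.≤-trans (ℕ.≤-reflexive (cong ∣_∣ (trans (ℤ.pos-+ w (b ℕ.* q)) (cong (λ y → + w + y) (ℤ.pos-* b q)))))
  (ℕ.m≤m+n _ _)
∣+∣-shift w b e@(-[1+ q ]) = begin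
  w ℕ.+ b ℕ.* ∣ e ∣                  ≡⟨ cong (w ℕ.+_) (ℤ.abs-* (+ b) e) ⟨
  w ℕ.+ ∣ + b * e ∣                  ≡⟨ cong (λ y → w ℕ.+ ∣ y ∣) (eq (+ w) (+ b * e)) ⟩
  w ℕ.+ ∣ (+ w + + b * e) - + w ∣    ≤⟨ ℕ.+-monoʳ-≤ w (ℤ.∣i-j∣≤∣i∣+∣j∣ (+ w + + b * e) (+ w)) ⟩
  w ℕ.+ (∣ + w + + b * e ∣ ℕ.+ w)    ≡⟨ eq′ w ∣ + w + + b * e ∣ ⟩
  ∣ + w + + b * e ∣ ℕ.+ 2 ℕ.* w      ≤⟨ ℕ.+-monoʳ-≤ ∣ + w + + b * e ∣ (ℕ.m≤m+n (2 ℕ.* w) _) ⟩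
  ∣ + w + + b * e ∣ ℕ.+ ∣ e ∣ ℕ.* (2 ℕ.* w) ∎
  where
  open ℕ.≤-Reasoning
  eq : ∀ w y → y ≡ (w + y) - w
  eq = solve-∀
  eq′ : ∀ w z → w ℕ.+ (z ℕ.+ w) ≡ z ℕ.+ 2 ℕ.* w
  eq′ = ℕ.solve-∀

-- The vector `ε` will be the contribution of C to the lattice vector; it costs at most its norm.
norm-shift : ∀ b (w : Vec ℕ p) (e ε : Vec ℤ p) → Vec.sum w ℕ.+ b ℕ.* norm e ℕ.≤
  norm (map +_ w ⊕ (scale (+ b) e ⊕ ε)) ℕ.+ (cost e (map (2 ℕ.*_) w) ℕ.+ norm ε)
norm-shift b []       []       []       = ℕ.≤-reflexive (ℕ.*-zeroʳ b)
norm-shift b (w ∷ ws) (e ∷ es) (ε ∷ εs) = begin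
  (w ℕ.+ Vec.sum ws) ℕ.+ b ℕ.* (∣ e ∣ ℕ.+ norm es)
    ≡⟨ eq w (Vec.sum ws) b ∣ e ∣ (norm es) ⟩
  (w ℕ.+ b ℕ.* ∣ e ∣) ℕ.+ (Vec.sum ws ℕ.+ b ℕ.* norm es)
    ≤⟨ ℕ.+-mono-≤ (∣+∣-shift w b e) (norm-shift b ws es εs) ⟩
  (∣ + w + + b * e ∣ ℕ.+ ∣ e ∣ ℕ.* (2 ℕ.* w)) ℕ.+ (N ℕ.+ (C ℕ.+ norm εs))
    ≤⟨ ℕ.+-monoˡ-≤ _ (ℕ.+-monoˡ-≤ (∣ e ∣ ℕ.* (2 ℕ.* w)) perturb) ⟩
  (∣ + w + (+ b * e + ε) ∣ ℕ.+ ∣ ε ∣ ℕ.+ ∣ e ∣ ℕ.* (2 ℕ.* w)) ℕ.+ (N ℕ.+ (C ℕ.+ norm εs))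
    ≡⟨ eq′ ∣ + w + (+ b * e + ε) ∣ ∣ ε ∣ (∣ e ∣ ℕ.* (2 ℕ.* w)) N C (norm εs) ⟩
  (∣ + w + (+ b * e + ε) ∣ ℕ.+ N) ℕ.+ ((∣ e ∣ ℕ.* (2 ℕ.* w) ℕ.+ C) ℕ.+ (∣ ε ∣ ℕ.+ norm εs)) ∎
  where
  open ℕ.≤-Reasoning
  N = norm (map +_ ws ⊕ (scale (+ b) es ⊕ εs))
  C = cost es (map (2 ℕ.*_) ws)
  eqε : ∀ w y ε → w + y ≡ (w + (y + ε)) - ε
  eqε = solve-∀
  perturb : ∣ + w + + b * e ∣ ℕ.≤ ∣ + w + (+ b * e + ε) ∣ ℕ.+ ∣ ε ∣
  perturb = ℕ.≤-trans (ℕ.≤-reflexive (cong ∣_∣ (eqε (+ w) (+ b * e) ε))) (ℤ.∣i-j∣≤∣i∣+∣j∣ (+ w + (+ b * e + ε)) ε)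
  eq : ∀ w s b e n → (w ℕ.+ s) ℕ.+ b ℕ.* (e ℕ.+ n) ≡ (w ℕ.+ b ℕ.* e) ℕ.+ (s ℕ.+ b ℕ.* n)
  eq = ℕ.solve-∀
  eq′ : ∀ a ε c n d f → (a ℕ.+ ε ℕ.+ c) ℕ.+ (n ℕ.+ (d ℕ.+ f)) ≡ (a ℕ.+ n) ℕ.+ ((c ℕ.+ d) ℕ.+ (ε ℕ.+ f))
  eq′ = ℕ.solve-∀

-- Moving w by the lattice vector with coordinates e gains b − 2wᵢ in norm for every unit of ∣eᵢ∣,
-- up to the perturbation by the i-th row of the matrix.
norm-minimal : ∀ b (w : Vec ℕ p) (rows : Vec (Vec ℤ p) p) →
  All (ℕ._≤ b) (zipWith ℕ._+_ (map (2 ℕ.*_) w) (map norm rows)) →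
  ∀ e → Vec.sum w ℕ.≤ norm (map +_ w ⊕ (scale (+ b) e ⊕ comb e rows))
norm-minimal b w rows small e = ℕ.+-cancelʳ-≤ (b ℕ.* norm e) _ _ (begin
  Vec.sum w ℕ.+ b ℕ.* norm e                              ≤⟨ norm-shift b w e (comb e rows) ⟩
  N ℕ.+ (cost e 2w ℕ.+ norm (comb e rows))                ≤⟨ ℕ.+-monoʳ-≤ N (ℕ.+-monoʳ-≤ (cost e 2w) (norm-comb e rows)) ⟩
  N ℕ.+ (cost e 2w ℕ.+ cost e (map norm rows))            ≡⟨ cong (N ℕ.+_) (cost-+ e 2w (map norm rows)) ⟨
  N ℕ.+ cost e (zipWith ℕ._+_ 2w (map norm rows))         ≤⟨ ℕ.+-monoʳ-≤ N (cost-≤ e small) ⟩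
  N ℕ.+ b ℕ.* norm e                                      ∎)
  where
  open ℕ.≤-Reasoning
  N  = norm (map +_ w ⊕ (scale (+ b) e ⊕ comb e rows))
  2w = map (2 ℕ.*_) w

at-linear : ∀ x (a b : Vec ℤ p) → at x (zipWith (λ c d → c ∷ d ∷ []) a b) ≡ scale x b ⊕ a
at-linear x []       []       = refl
at-linear x (a ∷ as) (b ∷ bs) = cong₂ _∷_ (eq a b x) (at-linear x as bs)
  where
  eq : ∀ a b x → a + x * (b + x * + 0) ≡ x * b + a
  eq = solve-∀

comb-linear : ∀ x (e : Vec ℤ r) (as bs : Vec (Vec ℤ p) r) →
  comb e (map (at x) (zipWith (zipWith λ c d → c ∷ d ∷ []) as bs)) ≡ scale x (comb e bs) ⊕ comb e as
comb-linear x []       []       []       = sym (trans (cong (_⊕ zeros) (scale-zeros x)) (⊕-identityʳ zeros))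
comb-linear x (e ∷ es) (a ∷ as) (b ∷ bs) = begin
  scale e (at x (zipWith _ a b)) ⊕ comb es (map (at x) _)                   ≡⟨ cong₂ (λ u v → scale e u ⊕ v) (at-linear x a b) (comb-linear x es as bs) ⟩
  scale e (scale x b ⊕ a) ⊕ (scale x (comb es bs) ⊕ comb es as)             ≡⟨ cong (_⊕ _) (scale-⊕ e (scale x b) a) ⟩
  (scale e (scale x b) ⊕ scale e a) ⊕ (scale x (comb es bs) ⊕ comb es as)   ≡⟨ ⊕-interchange (scale e (scale x b)) _ _ _ ⟩
  (scale e (scale x b) ⊕ scale x (comb es bs)) ⊕ (scale e a ⊕ comb es as)   ≡⟨ cong (λ u → (u ⊕ _) ⊕ _) swap ⟩
  (scale x (scale e b) ⊕ scale x (comb es bs)) ⊕ (scale e a ⊕ comb es as)   ≡⟨ cong (_⊕ _) (scale-⊕ x (scale e b) (comb es bs)) ⟨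
  scale x (scale e b ⊕ comb es bs) ⊕ (scale e a ⊕ comb es as)               ∎
  where
  open ≡-Reasoning
  swap : scale e (scale x b) ≡ scale x (scale e b)
  swap = trans (sym (scale-* e x b)) (trans (cong (λ c → scale c b) (ℤ.*-comm e x)) (scale-* x e b))

comb-edges : ∀ m (e : Vec ℤ 5) → comb e (map (at (+ m)) edges) ≡ scale (+ (m ℕ.* 12)) e ⊕ comb e perturbation
comb-edges m e = trans (comb-linear (+ m) e perturbation (units (+ 12)))
  (cong (_⊕ comb e perturbation) (begin
    scale (+ m) (comb e (units (+ 12)))   ≡⟨ cong (scale (+ m)) (comb-units (+ 12) e) ⟩
    scale (+ m) (scale (+ 12) e)          ≡⟨ scale-* (+ m) (+ 12) e ⟨
    scale (+ m * + 12) e                  ≡⟨ cong (λ c → scale c e) (ℤ.pos-* m 12) ⟨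
    scale (+ (m ℕ.* 12)) e                ∎))
  where open ≡-Reasoning

ones : Vec Poly 5
ones = replicate 5 (+ 1 ∷ [])

twice-corner : ∀ x → scale (+ 2) (at x corner) ≡ comb (at x ones) (map (at x) edges)
twice-corner x = begin
  scale (+ 2) (at x corner)             ≡⟨ scale-at (+ 2) corner ⟨
  at x (map (+ 2 ·ᴾ_) corner)           ≡⟨ ≈ᵛ-sound (map (+ 2 ·ᴾ_) corner) (combᴾ ones edges) x tt ⟩
  at x (combᴾ ones edges)               ≡⟨ at-combᴾ ones edges x ⟩
  comb (at x ones) (map (at x) edges)   ∎
  where
  open ≡-Reasoning
  scale-at : ∀ c (q : Vec Poly p) → at x (map (c ·ᴾ_) q) ≡ scale c (at x q)
  scale-at c []       = refl
  scale-at c (q ∷ qs) = cong₂ _∷_ (⟦⟧-· c q x) (scale-at c qs)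

-- Twice the corner is the sum of the edges, so an even multiple of the corner is absorbed by adding
-- `h` to every edge coefficient.
comb-even : ∀ x h d → comb (h * + 2 ∷ d) (map (at x) basis) ≡ comb (scale h (at x ones) ⊕ d) (map (at x) edges)
comb-even x h d = begin
  scale (h * + 2) (at x corner) ⊕ comb d E        ≡⟨ cong (_⊕ comb d E) (scale-* h (+ 2) (at x corner)) ⟩
  scale h (scale (+ 2) (at x corner)) ⊕ comb d E  ≡⟨ cong (λ u → scale h u ⊕ comb d E) (twice-corner x) ⟩
  scale h (comb (at x ones) E) ⊕ comb d E         ≡⟨ cong (_⊕ comb d E) (comb-scale h (at x ones) E) ⟨
  comb (scale h (at x ones)) E ⊕ comb d E         ≡⟨ comb-⊕ (scale h (at x ones)) d E ⟨
  comb (scale h (at x ones) ⊕ d) E                ∎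
  where
  open ≡-Reasoning
  E = map (at x) edges

-- Up to sign and an even multiple of the corner b, adding an odd multiple of b turns w into its
-- mirror image b − w.
reflect : ∀ h (w b s : Vec ℤ p) →
  map -_ (w ⊕ (scale (+ 1 + h * + 2) b ⊕ s)) ≡ (b ⊝ w) ⊕ (scale ((- + 1 - h) * + 2) b ⊕ scale (- + 1) s)
reflect h []       []       []       = refl
reflect h (w ∷ ws) (b ∷ bs) (s ∷ ss) = cong₂ _∷_ (eq h w b s) (reflect h ws bs ss)
  where
  eq : ∀ h w b s → - (w + ((+ 1 + h * + 2) * b + s)) ≡ (b - w) + ((- + 1 - h) * + 2 * b + - + 1 * s)
  eq = solve-∀

parity : ∀ z → ∃[ h ] (z ≡ h * + 2 ⊎ z ≡ + 1 + h * + 2)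
parity z with z %ℕ 2 | n%ℕd<d z 2 | a≡a%ℕn+[a/ℕn]*n z 2
... | 0 | _ | eq = z /ℕ 2 , inj₁ (trans eq (ℤ.+-identityˡ _))
... | 1 | _ | eq = z /ℕ 2 , inj₂ eq
... | suc (suc _) | s≤s (s≤s ()) | _

⊕-⊝-restore : (w a : Vec ℤ p) → w ⊕ (a ⊝ w) ≡ a
⊕-⊝-restore []       []       = refl
⊕-⊝-restore (w ∷ ws) (a ∷ as) = cong₂ _∷_ (eq w a) (⊕-⊝-restore ws as)
  where
  eq : ∀ w a → w + (a - w) ≡ a
  eq = solve-∀

-- By `span` the difference `a ⊝ w` lies in the lattice, so `a` is one of the translates covered by
-- `minimal`.
congruent-norm : ∀ {k} x w → (∀ c → k ℕ.≤ norm (w ⊕ comb c (map (at x) basis))) →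
  ∀ {g n} → at x gensᴾ ≡ g → ⟦ orderᴾ ⟧ x ≡ n → ∀ a → n ∣ dot w g - dot a g → k ℕ.≤ norm a
congruent-norm {k} x w minimal refl refl a (divides q eq) = subst (λ v → k ℕ.≤ norm v)
  (trans (cong (w ⊕_) (sym (proj₂ spanned))) (⊕-⊝-restore w a)) (minimal (proj₁ spanned))
  where
  flip : ∀ u v → u - v ≡ - (v - u)
  flip = solve-∀
  a-w·g≡ : dot (a ⊝ w) (at x gensᴾ) ≡ - q * ⟦ orderᴾ ⟧ x
  a-w·g≡ = trans (dot-⊝ a w (at x gensᴾ)) (trans (flip (dot a (at x gensᴾ)) (dot w (at x gensᴾ)))
    (trans (cong -_ eq) (ℤ.neg-distribˡ-* q (⟦ orderᴾ ⟧ x))))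
  spanned = span x (a ⊝ w) (- q) a-w·g≡

module LowerBound (t : ℕ) where
  m = suc t
  x = + m

  -- Half the corner is (3m + ½, 3m + ½, 3m + 1, 3m - ½, 3m + 1). The half-integers are rounded in
  -- opposite directions, so `hole` and `hole′` add up to the corner and have norms k and k + 1.
  -- Writing m = t + 1 keeps the entries natural without subtraction.
  hole hole′ : Vec ℕ 5
  hole  = (3 ℕ.+ 3 ℕ.* t) ∷ (3 ℕ.+ 3 ℕ.* t) ∷ (4 ℕ.+ 3 ℕ.* t) ∷ (3 ℕ.+ 3 ℕ.* t) ∷ (4 ℕ.+ 3 ℕ.* t) ∷ []
  hole′ = (4 ℕ.+ 3 ℕ.* t) ∷ (4 ℕ.+ 3 ℕ.* t) ∷ (4 ℕ.+ 3 ℕ.* t) ∷ (2 ℕ.+ 3 ℕ.* t) ∷ (4 ℕ.+ 3 ℕ.* t) ∷ []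

  sum-hole : Vec.sum hole ≡ diameterOf m
  sum-hole = eq t
    where
    eq : ∀ t → (3 ℕ.+ 3 ℕ.* t) ℕ.+ ((3 ℕ.+ 3 ℕ.* t) ℕ.+ ((4 ℕ.+ 3 ℕ.* t) ℕ.+ ((3 ℕ.+ 3 ℕ.* t) ℕ.+ ((4 ℕ.+ 3 ℕ.* t) ℕ.+ 0))))
      ≡ 15 ℕ.* (1 ℕ.+ t) ℕ.+ 2
    eq = ℕ.solve-∀

  sum-hole′ : Vec.sum hole′ ≡ suc (diameterOf m)
  sum-hole′ = eq t
    where
    eq : ∀ t → (4 ℕ.+ 3 ℕ.* t) ℕ.+ ((4 ℕ.+ 3 ℕ.* t) ℕ.+ ((4 ℕ.+ 3 ℕ.* t) ℕ.+ ((2 ℕ.+ 3 ℕ.* t) ℕ.+ ((4 ℕ.+ 3 ℕ.* t) ℕ.+ 0))))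
      ≡ 1 ℕ.+ (15 ℕ.* (1 ℕ.+ t) ℕ.+ 2)
    eq = ℕ.solve-∀

  -- Here `c` is the constant term of a coordinate and `d` the norm of the matching row of C. The
  -- slopes in t are 6 and 12, so only the constants need comparing; 2·4 + 4 and 2·3 + 6 attain the
  -- bound 12.
  small : ∀ c d → 2 ℕ.* c ℕ.+ d ℕ.≤ 12 → 2 ℕ.* (c ℕ.+ 3 ℕ.* t) ℕ.+ d ℕ.≤ m ℕ.* 12
  small c d h = subst₂ ℕ._≤_ (eq c d t) (eq′ t) (ℕ.+-mono-≤ h (ℕ.*-monoˡ-≤ t (ℕ.m≤m+n 6 6)))
    where
    eq : ∀ c d t → (2 ℕ.* c ℕ.+ d) ℕ.+ 6 ℕ.* t ≡ 2 ℕ.* (c ℕ.+ 3 ℕ.* t) ℕ.+ d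
    eq = ℕ.solve-∀
    eq′ : ∀ t → 12 ℕ.+ 12 ℕ.* t ≡ (1 ℕ.+ t) ℕ.* 12
    eq′ = ℕ.solve-∀

  hole-minimal : ∀ e → diameterOf m ℕ.≤ norm (map +_ hole ⊕ comb e (map (at x) edges))
  hole-minimal e = subst₂ (λ s v → s ℕ.≤ norm (map +_ hole ⊕ v)) sum-hole (sym (comb-edges m e))
    (norm-minimal (m ℕ.* 12) hole perturbation
      (small 3 4 ℕ≤ ∷ small 3 4 ℕ≤ ∷ small 4 4 ℕ≤ ∷ small 3 6 ℕ≤ ∷ small 4 4 ℕ≤ ∷ []) e)
    where
    ℕ≤ : ∀ {a} {_ : T (a ℕ.≤ᵇ 12)} → a ℕ.≤ 12
    ℕ≤ {_} {h} = ℕ.≤ᵇ⇒≤ _ _ h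

  hole′-minimal : ∀ e → diameterOf m ℕ.≤ norm (map +_ hole′ ⊕ comb e (map (at x) edges))
  hole′-minimal e = ℕ.≤-trans (ℕ.n≤1+n _) (subst₂ (λ s v → s ℕ.≤ norm (map +_ hole′ ⊕ v)) sum-hole′ (sym (comb-edges m e))
    (norm-minimal (m ℕ.* 12) hole′ perturbation
      (small 4 4 ℕ≤ ∷ small 4 4 ℕ≤ ∷ small 4 4 ℕ≤ ∷ small 2 6 ℕ≤ ∷ small 4 4 ℕ≤ ∷ []) e))
    where
    ℕ≤ : ∀ {a} {_ : T (a ℕ.≤ᵇ 12)} → a ℕ.≤ 12
    ℕ≤ {_} {h} = ℕ.≤ᵇ⇒≤ _ _ h

  corner⊝hole : at x corner ⊝ map +_ hole ≡ map +_ hole′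
  corner⊝hole = cong₂ _∷_ (entry 3 4 (+ 1 ∷ + 6 ∷ []) (eq₁ (+ t)))
    (cong₂ _∷_ (entry 3 4 (+ 1 ∷ + 6 ∷ []) (eq₁ (+ t)))
    (cong₂ _∷_ (entry 4 4 (+ 2 ∷ + 6 ∷ []) (eq₂ (+ t)))
    (cong₂ _∷_ (entry 3 2 (- + 1 ∷ + 6 ∷ []) (eq₃ (+ t)))
    (cong₂ _∷_ (entry 4 4 (+ 2 ∷ + 6 ∷ []) (eq₂ (+ t))) refl))))
    where
    pos : ∀ c → + (c ℕ.+ 3 ℕ.* t) ≡ + c + + 3 * + t
    pos c = trans (ℤ.pos-+ c _) (cong (λ y → + c + y) (ℤ.pos-* 3 t))
    entry : ∀ c d q → ⟦ q ⟧ x - (+ c + + 3 * + t) ≡ + d + + 3 * + t → ⟦ q ⟧ x - + (c ℕ.+ 3 ℕ.* t) ≡ + (d ℕ.+ 3 ℕ.* t)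
    entry c d q h = trans (cong (λ z → ⟦ q ⟧ x - z) (pos c)) (trans h (sym (pos d)))
    eq₁ : ∀ t → (+ 1 + (+ 1 + t) * (+ 6 + (+ 1 + t) * + 0)) - (+ 3 + + 3 * t) ≡ + 4 + + 3 * t
    eq₁ = solve-∀
    eq₂ : ∀ t → (+ 2 + (+ 1 + t) * (+ 6 + (+ 1 + t) * + 0)) - (+ 4 + + 3 * t) ≡ + 4 + + 3 * t
    eq₂ = solve-∀
    eq₃ : ∀ t → (- + 1 + (+ 1 + t) * (+ 6 + (+ 1 + t) * + 0)) - (+ 3 + + 3 * t) ≡ + 2 + + 3 * t
    eq₃ = solve-∀

  -- Only the parity of the coefficient of the corner matters: an even one dissolves into edges, and
  -- an odd one becomes even after reflection, with `hole′` in place of `hole`.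
  coset-minimal : ∀ c → diameterOf m ℕ.≤ norm (map +_ hole ⊕ comb c (map (at x) basis))
  coset-minimal (z ∷ d) with parity z
  ... | h , inj₁ refl = subst (λ v → diameterOf m ℕ.≤ norm (map +_ hole ⊕ v)) (sym (comb-even x h d)) (hole-minimal (scale h (at x ones) ⊕ d))
  ... | h , inj₂ refl = subst (diameterOf m ℕ.≤_) (begin
    norm (map +_ hole′ ⊕ comb (scale h′ (at x ones) ⊕ scale (- + 1) d) E)              ≡⟨ cong (λ v → norm (map +_ hole′ ⊕ v)) (comb-even x h′ (scale (- + 1) d)) ⟨
    norm (map +_ hole′ ⊕ (scale (h′ * + 2) b ⊕ comb (scale (- + 1) d) E))              ≡⟨ cong₂ (λ u v → norm (u ⊕ (scale (h′ * + 2) b ⊕ v))) (sym corner⊝hole) (comb-scale (- + 1) d E) ⟩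
    norm ((b ⊝ map +_ hole) ⊕ (scale (h′ * + 2) b ⊕ scale (- + 1) (comb d E)))         ≡⟨ cong norm (reflect h (map +_ hole) b (comb d E)) ⟨
    norm (map -_ (map +_ hole ⊕ (scale (+ 1 + h * + 2) b ⊕ comb d E)))                 ≡⟨ norm-map-neg (map +_ hole ⊕ (scale (+ 1 + h * + 2) b ⊕ comb d E)) ⟩
    norm (map +_ hole ⊕ (scale (+ 1 + h * + 2) b ⊕ comb d E))                          ∎)
    (hole′-minimal (scale h′ (at x ones) ⊕ scale (- + 1) d))
    where
    open ≡-Reasoning
    E = map (at x) edges
    b = at x corner
    h′ = - + 1 - h

-- Distances from lattice points, estimated on boxes with polynomial bounds.

Interval : Set
Interval = Poly × Poly

_∈[_]_ : ℤ → ℤ → Interval → Set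
y ∈[ x ] (l , h) = ⟦ l ⟧ x ≤ y × y ≤ ⟦ h ⟧ x

Box : ℕ → Set
Box p = Vec Interval p

Inside : ℤ → Vec ℤ p → Box p → Set
Inside x = Pointwise (_∈[ x ]_)

-- Integrality lets the upper part start at c + 1. The former bound on the side that is cut is
-- discarded.
below above : Fin p → Poly → Box p → Box p
below zero    c ((l , h) ∷ b) = (l , c) ∷ b
below (suc i) c (I ∷ b)       = I ∷ below i c b
above zero    c ((l , h) ∷ b) = ((+ 1 ∷ []) +ᴾ c , h) ∷ b
above (suc i) c (I ∷ b)       = I ∷ above i c b

split : ∀ {x} {y : Vec ℤ p} i c {b} → Inside x y b → Inside x y (below i c b) ⊎ Inside x y (above i c b)
split {x = x} {y ∷ _} zero c ((l≤y , y≤h) ∷ ys) with y ℤ.≤? ⟦ c ⟧ x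
... | yes y≤c = inj₁ ((l≤y , y≤c) ∷ ys)
... | no  y≰c = inj₂ ((subst (_≤ y) c+1≡ (ℤ.i<j⇒suc[i]≤j (ℤ.≰⇒> y≰c)) , y≤h) ∷ ys)
  where
  c+1≡ : ℤ.suc (⟦ c ⟧ x) ≡ ⟦ (+ 1 ∷ []) +ᴾ c ⟧ x
  c+1≡ = sym (trans (⟦⟧-+ (+ 1 ∷ []) c x) (cong (λ z → + 1 + z + ⟦ c ⟧ x) (ℤ.*-zeroʳ x)))
split (suc i) c (y∈I ∷ ys) with split i c ys
... | inj₁ ys′ = inj₁ (y∈I ∷ ys′)
... | inj₂ ys′ = inj₂ (y∈I ∷ ys′)

-- A triple (c , l , h) stands for the estimate d ≤ c + (y″ − y′) of a distance d from a point
-- y = y′ + y″ with l ≤ y′ and y″ ≤ h.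
Estimate : Set
Estimate = Poly × Poly × Poly

Holds : ℤ → (d y : ℤ) → Estimate → Set
Holds x d y (c , l , h) = ∃[ y′ ] ∃[ y″ ]
  y ≡ y′ + y″ × d ≤ ⟦ c ⟧ x + (y″ - y′) × ⟦ l ⟧ x ≤ y′ × y″ ≤ ⟦ h ⟧ x

absᴾ : Poly → Poly
absᴾ = List.map (λ c → + ∣ c ∣)

absᴾ-sound : ∀ q {x} → + 0 ≤ x → + ∣ ⟦ q ⟧ x ∣ ≤ ⟦ absᴾ q ⟧ x
absᴾ-sound []      0≤x = ℤ.≤-refl
absᴾ-sound (c ∷ q) {x} 0≤x = begin
  + ∣ c + x * ⟦ q ⟧ x ∣                   ≤⟨ ℤ.+≤+ (ℤ.∣i+j∣≤∣i∣+∣j∣ c (x * ⟦ q ⟧ x)) ⟩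
  + (∣ c ∣ ℕ.+ ∣ x * ⟦ q ⟧ x ∣)           ≡⟨ ℤ.pos-+ ∣ c ∣ _ ⟩
  + ∣ c ∣ + + ∣ x * ⟦ q ⟧ x ∣             ≡⟨ cong (λ z → + ∣ c ∣ + + z) (ℤ.abs-* x (⟦ q ⟧ x)) ⟩
  + ∣ c ∣ + + (∣ x ∣ ℕ.* ∣ ⟦ q ⟧ x ∣)     ≡⟨ cong (λ z → + ∣ c ∣ + z) (ℤ.pos-* ∣ x ∣ _) ⟩
  + ∣ c ∣ + + ∣ x ∣ * + ∣ ⟦ q ⟧ x ∣       ≡⟨ cong (λ z → + ∣ c ∣ + z * + ∣ ⟦ q ⟧ x ∣) (ℤ.0≤i⇒+∣i∣≡i 0≤x) ⟩
  + ∣ c ∣ + x * + ∣ ⟦ q ⟧ x ∣             ≤⟨ ℤ.+-monoʳ-≤ (+ ∣ c ∣) (ℤ.*-monoˡ-≤-nonNeg x (absᴾ-sound q 0≤x)) ⟩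
  + ∣ c ∣ + x * ⟦ absᴾ q ⟧ x              ∎
  where
  open ℤ.≤-Reasoning
  instance _ = ℤ.nonNegative 0≤x

-- If y ≤ w on the interval, the distance is w - y and y is counted in y′; if w ≤ y, it is y - w and
-- y is counted in y″. If neither is certified, the triangle inequality gives ∣w∣ + y. The tests are
-- one-sided, but a failure only weakens the estimate.
estimate : Interval → Poly → Estimate
estimate (l , h) w = if h ≤ᴾ w then (w , l , []) else
  if w ≤ᴾ l then (-ᴾ w , [] , h) else (absᴾ w , [] , h)

estimate-sound : ∀ {x y} I w → + 1 ≤ x → + 0 ≤ y → y ∈[ x ] I → Holds x (+ ∣ y - ⟦ w ⟧ x ∣) y (estimate I w)
estimate-sound {x} {y} (l , h) w 1≤x 0≤y (l≤y , y≤h) with h ≤ᴾ w | ≤ᴾ-sound h w 1≤x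
... | true | h≤w = y , + 0 , sym (ℤ.+-identityʳ y) , dist , l≤y , ℤ.≤-refl
  where
  eq : ∀ w y → w - y ≡ w + (+ 0 - y)
  eq = solve-∀
  dist : + ∣ y - ⟦ w ⟧ x ∣ ≤ ⟦ w ⟧ x + (+ 0 - y)
  dist = ℤ.≤-reflexive (trans (cong +_ (ℤ.∣i-j∣≡∣j-i∣ y (⟦ w ⟧ x)))
    (trans (ℤ.0≤i⇒+∣i∣≡i (ℤ.i≤j⇒0≤j-i (ℤ.≤-trans y≤h (h≤w tt)))) (eq (⟦ w ⟧ x) y)))
... | false | _ with w ≤ᴾ l | ≤ᴾ-sound w l 1≤x
... | true | w≤l = + 0 , y , sym (ℤ.+-identityˡ y) , dist , ℤ.≤-refl , y≤h
  where
  eq : ∀ w y → y - w ≡ - w + (y - + 0)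
  eq = solve-∀
  dist : + ∣ y - ⟦ w ⟧ x ∣ ≤ ⟦ -ᴾ w ⟧ x + (y - + 0)
  dist = ℤ.≤-reflexive (trans (ℤ.0≤i⇒+∣i∣≡i (ℤ.i≤j⇒0≤j-i (ℤ.≤-trans (w≤l tt) l≤y)))
    (trans (eq (⟦ w ⟧ x) y) (cong (_+ (y - + 0)) (sym (⟦⟧-neg w x)))))
... | false | _ = + 0 , y , sym (ℤ.+-identityˡ y) , dist , ℤ.≤-refl , y≤h
  where
  eq : ∀ a y → y + a ≡ a + (y - + 0)
  eq = solve-∀
  open ℤ.≤-Reasoning
  dist : + ∣ y - ⟦ w ⟧ x ∣ ≤ ⟦ absᴾ w ⟧ x + (y - + 0)
  dist = begin
    + ∣ y - ⟦ w ⟧ x ∣               ≤⟨ ℤ.+≤+ (ℤ.∣i-j∣≤∣i∣+∣j∣ y (⟦ w ⟧ x)) ⟩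
    + (∣ y ∣ ℕ.+ ∣ ⟦ w ⟧ x ∣)       ≡⟨ ℤ.pos-+ ∣ y ∣ _ ⟩
    + ∣ y ∣ + + ∣ ⟦ w ⟧ x ∣         ≡⟨ cong (_+ + ∣ ⟦ w ⟧ x ∣) (ℤ.0≤i⇒+∣i∣≡i 0≤y) ⟩
    y + + ∣ ⟦ w ⟧ x ∣               ≤⟨ ℤ.+-monoʳ-≤ y (absᴾ-sound w (ℤ.≤-trans (ℤ.+≤+ z≤n) 1≤x)) ⟩
    y + ⟦ absᴾ w ⟧ x                ≡⟨ eq (⟦ absᴾ w ⟧ x) y ⟩
    ⟦ absᴾ w ⟧ x + (y - + 0)        ∎

sumℤ : Vec ℤ p → ℤ
sumℤ []       = + 0
sumℤ (y ∷ ys) = y + sumℤ ys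

_+ᴱ_ : Estimate → Estimate → Estimate
(c , l , h) +ᴱ (c′ , l′ , h′) = c +ᴾ c′ , l +ᴾ l′ , h +ᴾ h′

Holds-+ : ∀ {x d d′ y y′} E E′ → Holds x d y E → Holds x d′ y′ E′ → Holds x (d + d′) (y + y′) (E +ᴱ E′)
Holds-+ {x} (c , l , h) (c′ , l′ , h′) (p , q , refl , d≤ , l≤ , ≤h) (p′ , q′ , refl , d′≤ , l′≤ , ≤h′) =
  p + p′ , q + q′ , eq p q p′ q′ ,
  subst (_ ≤_) (trans (eq′ (⟦ c ⟧ x) (⟦ c′ ⟧ x) p q p′ q′) (cong (_+ (q + q′ - (p + p′))) (sym (⟦⟧-+ c c′ x)))) (ℤ.+-mono-≤ d≤ d′≤) ,
  subst (_≤ p + p′) (sym (⟦⟧-+ l l′ x)) (ℤ.+-mono-≤ l≤ l′≤) ,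
  subst (q + q′ ≤_) (sym (⟦⟧-+ h h′ x)) (ℤ.+-mono-≤ ≤h ≤h′)
  where
  eq : ∀ p q p′ q′ → (p + q) + (p′ + q′) ≡ (p + p′) + (q + q′)
  eq = solve-∀
  eq′ : ∀ c c′ p q p′ q′ → (c + (q - p)) + (c′ + (q′ - p′)) ≡ (c + c′) + (q + q′ - (p + p′))
  eq′ = solve-∀

estimates : Box p → Vec Poly p → Estimate
estimates []      []       = [] , [] , []
estimates (I ∷ b) (w ∷ ws) = estimate I w +ᴱ estimates b ws

estimates-sound : ∀ {x} {y : Vec ℤ p} {b} w → + 1 ≤ x → All (+ 0 ≤_) y → Inside x y b →
  Holds x (+ norm (y ⊝ at x w)) (sumℤ y) (estimates b w)
estimates-sound [] 1≤x [] [] = + 0 , + 0 , refl , ℤ.≤-refl , ℤ.≤-refl , ℤ.≤-refl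
estimates-sound {x = x} {y ∷ ys} {I ∷ b} (w ∷ ws) 1≤x (0≤y ∷ 0≤ys) (y∈I ∷ ys∈b) =
  subst (λ d → Holds x d (y + sumℤ ys) (estimate I w +ᴱ estimates b ws))
    (sym (ℤ.pos-+ ∣ y - ⟦ w ⟧ x ∣ (norm (ys ⊝ at x ws))))
    (Holds-+ (estimate I w) (estimates b ws) (estimate-sound I w 1≤x 0≤y y∈I) (estimates-sound ws 1≤x 0≤ys ys∈b))

-- With s = y′ + y″ the estimate reads d ≤ c + s - 2y′, or equally d ≤ c + 2y″ - s. The first
-- disjunct inserts y′ ≥ l, the second y″ ≤ h.
beats : Poly → Estimate → Bool
beats s (c , l , h) = (((+ 1 ∷ []) +ᴾ c) ≤ᴾ (l +ᴾ l)) ∨ (((+ 1 ∷ []) +ᴾ c +ᴾ (h +ᴾ h)) ≤ᴾ (s +ᴾ s))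

beats-sound : ∀ {x d} s E → + 1 ≤ x → T (beats s E) → Holds x d (⟦ s ⟧ x) E → + 1 + d ≤ ⟦ s ⟧ x
beats-sound {x} {d} s (c , l , h) 1≤x ok (p , q , s≡ , d≤ , l≤ , ≤h) =
  case (to (T-∨ {((+ 1 ∷ []) +ᴾ c) ≤ᴾ (l +ᴾ l)}) ok)
  where
  open ℤ.≤-Reasoning
  one+ : ∀ r → ⟦ (+ 1 ∷ []) +ᴾ r ⟧ x ≡ + 1 + ⟦ r ⟧ x
  one+ r = trans (⟦⟧-+ (+ 1 ∷ []) r x) (cong (λ z → + 1 + z + ⟦ r ⟧ x) (ℤ.*-zeroʳ x))
  case : T (((+ 1 ∷ []) +ᴾ c) ≤ᴾ (l +ᴾ l)) ⊎ T (((+ 1 ∷ []) +ᴾ c +ᴾ (h +ᴾ h)) ≤ᴾ (s +ᴾ s)) → + 1 + d ≤ ⟦ s ⟧ x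
  case (inj₁ ok) = begin
    + 1 + d                                ≤⟨ ℤ.+-monoʳ-≤ (+ 1) d≤ ⟩
    + 1 + (⟦ c ⟧ x + (q - p))              ≡⟨ ℤ.+-assoc (+ 1) (⟦ c ⟧ x) (q - p) ⟨
    + 1 + ⟦ c ⟧ x + (q - p)                ≡⟨ cong (_+ (q - p)) (one+ c) ⟨
    ⟦ (+ 1 ∷ []) +ᴾ c ⟧ x + (q - p)        ≤⟨ ℤ.+-monoˡ-≤ (q - p) (≤ᴾ-sound ((+ 1 ∷ []) +ᴾ c) (l +ᴾ l) 1≤x ok) ⟩
    ⟦ l +ᴾ l ⟧ x + (q - p)                 ≡⟨ cong (_+ (q - p)) (⟦⟧-+ l l x) ⟩
    ⟦ l ⟧ x + ⟦ l ⟧ x + (q - p)            ≤⟨ ℤ.+-monoˡ-≤ (q - p) (ℤ.+-mono-≤ l≤ l≤) ⟩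
    p + p + (q - p)                        ≡⟨ eq p q ⟩
    p + q                                  ≡⟨ s≡ ⟨
    ⟦ s ⟧ x                                ∎
    where
    eq : ∀ p q → p + p + (q - p) ≡ p + q
    eq = solve-∀
  case (inj₂ ok) = begin
    + 1 + d                                              ≤⟨ ℤ.+-monoʳ-≤ (+ 1) d≤ ⟩
    + 1 + (⟦ c ⟧ x + (q - p))                            ≡⟨ eq (⟦ c ⟧ x) p q ⟩
    + 1 + ⟦ c ⟧ x + (q + q) - (p + q)                    ≤⟨ ℤ.+-monoˡ-≤ (- (p + q)) (ℤ.+-monoʳ-≤ (+ 1 + ⟦ c ⟧ x) (ℤ.+-mono-≤ ≤h ≤h)) ⟩
    + 1 + ⟦ c ⟧ x + (⟦ h ⟧ x + ⟦ h ⟧ x) - (p + q)        ≡⟨ cong₂ (λ u v → u + v - (p + q)) (sym (one+ c)) (sym (⟦⟧-+ h h x)) ⟩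
    ⟦ (+ 1 ∷ []) +ᴾ c ⟧ x + ⟦ h +ᴾ h ⟧ x - (p + q)       ≡⟨ cong (_- (p + q)) (⟦⟧-+ ((+ 1 ∷ []) +ᴾ c) (h +ᴾ h) x) ⟨
    ⟦ (+ 1 ∷ []) +ᴾ c +ᴾ (h +ᴾ h) ⟧ x - (p + q)          ≤⟨ ℤ.+-monoˡ-≤ (- (p + q)) (≤ᴾ-sound ((+ 1 ∷ []) +ᴾ c +ᴾ (h +ᴾ h)) (s +ᴾ s) 1≤x ok) ⟩
    ⟦ s +ᴾ s ⟧ x - (p + q)                               ≡⟨ cong₂ _-_ (⟦⟧-+ s s x) (sym s≡) ⟩
    ⟦ s ⟧ x + ⟦ s ⟧ x - ⟦ s ⟧ x                          ≡⟨ eq′ (⟦ s ⟧ x) ⟩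
    ⟦ s ⟧ x                                              ∎
    where
    eq : ∀ c p q → + 1 + (c + (q - p)) ≡ + 1 + c + (q + q) - (p + q)
    eq = solve-∀
    eq′ : ∀ s → s + s - s ≡ s
    eq′ = solve-∀

-- Decision trees for the orthants.

signed : Bool → ℤ → ℤ
signed false a = a
signed true  a = - a

signedᴾ : Bool → Poly → Poly
signedᴾ false q = q
signedᴾ true  q = -ᴾ q

at-signedᴾ : ∀ (σ : Vec Bool p) (v : Vec Poly p) x → at x (zipWith signedᴾ σ v) ≡ zipWith signed σ (at x v)
at-signedᴾ []          []      x = refl
at-signedᴾ (false ∷ σ) (q ∷ v) x = cong (_ ∷_) (at-signedᴾ σ v x)
at-signedᴾ (true  ∷ σ) (q ∷ v) x = cong₂ _∷_ (⟦⟧-neg q x) (at-signedᴾ σ v x)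

bits : ∀ p → ℕ → Vec Bool p
bits zero    n = []
bits (suc p) n = (n % 2 ≡ᵇ 1) ∷ bits p (n / 2)

-- U S is the sum of the edges in the set S, V S the corner with signs + on S and − off S, all
-- relative to the signs of the point; sets are bit masks. The thresholds for the absolute value of
-- a coordinate are near e = e, half e = 6m − 3 + e and full = 12m + 1.
data Tree : Set where
  U V       : ℕ → Tree
  near half : Fin 5 → ℕ → Tree → Tree → Tree
  full      : Fin 5 → Tree → Tree → Tree

edgeSum cornerSum : Vec Bool 5 → ℕ → Vec Poly 6
edgeSum   σ S = []         ∷ zipWith (λ s b → if b then (signed s (+ 1) ∷ []) else []) σ (bits 5 S)
-- Subtracting uᵢ from ½(u₁ + ⋯ + u₅) reverses the sign of uᵢ in it.
cornerSum σ S = (+ 1 ∷ []) ∷ zipWith (λ s b → if s xor b then [] else (- + 1 ∷ [])) σ (bits 5 S)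

threshold-half : ℕ → Poly
threshold-half e = (+ e - + 3) ∷ + 6 ∷ []

-- The radius k + 1. A leaf has to gain only 1.
sphereᴾ : Poly
sphereᴾ = + 3 ∷ + 15 ∷ []

leaf : Vec Bool 5 → Box 5 → Vec Poly 6 → Bool
leaf σ b c = beats sphereᴾ (estimates b (zipWith signedᴾ σ (combᴾ c basis)))

check : Vec Bool 5 → Box 5 → Tree → Bool
check σ b (U S)          = leaf σ b (edgeSum σ S)
check σ b (V S)          = leaf σ b (cornerSum σ S)
check σ b (near i e s t) = check σ (below i (+ e ∷ []) b) s ∧ check σ (above i (+ e ∷ []) b) t
check σ b (half i e s t) = check σ (below i (threshold-half e) b) s ∧ check σ (above i (threshold-half e) b) t
check σ b (full i s t)   = check σ (below i (+ 1 ∷ + 12 ∷ []) b) s ∧ check σ (above i (+ 1 ∷ + 12 ∷ []) b) t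

module _ {x : ℤ} (1≤x : + 1 ≤ x) (σ : Vec Bool 5) {y : Vec ℤ 5}
  (0≤y : All (+ 0 ≤_) y) (y∈sphere : sumℤ y ≡ ⟦ sphereᴾ ⟧ x) where

  Improvable : Set
  Improvable = ∃[ c ] + 1 + + norm (y ⊝ zipWith signed σ (comb c (map (at x) basis))) ≤ ⟦ sphereᴾ ⟧ x

  leaf-sound : ∀ b c → T (leaf σ b c) → Inside x y b → Improvable
  leaf-sound b c ok y∈b = at x c , subst (λ v → + 1 + + norm (y ⊝ v) ≤ ⟦ sphereᴾ ⟧ x)
    (trans (at-signedᴾ σ (combᴾ c basis) x) (cong (zipWith signed σ) (at-combᴾ c basis x)))
    (beats-sound sphereᴾ (estimates b w) 1≤x ok
      (subst (λ s → Holds x (+ norm (y ⊝ at x w)) s (estimates b w)) y∈sphere (estimates-sound w 1≤x 0≤y y∈b)))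
    where
    w = zipWith signedᴾ σ (combᴾ c basis)

  check-sound : ∀ b t → T (check σ b t) → Inside x y b → Improvable
  split-sound : ∀ i c b s t → T (check σ (below i c b) s ∧ check σ (above i c b) t) → Inside x y b → Improvable
  check-sound b (U S)          = leaf-sound b (edgeSum σ S)
  check-sound b (V S)          = leaf-sound b (cornerSum σ S)
  check-sound b (near i e s t) = split-sound i (+ e ∷ []) b s t
  check-sound b (half i e s t) = split-sound i (threshold-half e) b s t
  check-sound b (full i s t)   = split-sound i (+ 1 ∷ + 12 ∷ []) b s t
  split-sound i c b s t ok y∈b with to (T-∧ {check σ (below i c b) s}) ok | split i c y∈b
  ... | ok₁ , _ | inj₁ y∈below = check-sound (below i c b) s ok₁ y∈below
  ... | _ , ok₂ | inj₂ y∈above = check-sound (above i c b) t ok₂ y∈above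

-- The masks 1, 2, 4, 8, 16 are the single edges. The off-diagonal part of uᵢ has norm 2, or 4 for i
-- = 4, so subtracting uᵢ pays off once ∣xᵢ∣ ≥ 6m + 3, or 6m + 4 for i = 4. The split at 12m + 1
-- tells `estimate` on which side of the diagonal entry 12m + 2 the coordinate lies. In the box left
-- for `t` all coordinates are at most 6m + 2, the fourth at most 6m + 3.
capped : Tree → Tree
capped t =
  full 0F (half 0F 5 (full 1F (half 1F 5 (full 2F (half 2F 5 (full 3F (half 3F 6 (full 4F (half 4F 5
    t (U 16)) (U 16)) (U 8)) (U 8)) (U 4)) (U 4)) (U 2)) (U 2)) (U 1)) (U 1)

-- Certificates, indexed by the signs of the last four coordinates; their validity rests on
-- `trees-check` alone. A leaf `U 0` translates by 0 and so passes only on a box that misses the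
-- sphere, typically because its upper bounds add up to less than k + 1.
tree : Vec Bool 4 → Tree
tree (false ∷ false ∷ false ∷ false ∷ []) =
  near 4F 0 (near 2F 0 (near 0F 1 (U 8) (near 1F 1 (U 8) (half 3F 4 (V 11) (U 8)))) (half 0F 4 (half 3F 3
  (V 15) (near 1F 0 (near 0F 2 (U 12) (half 3F 4 (V 13) (U 8))) (near 0F 0 (half 2F 4 (half 3F 4 (V 14) (U 8))
  (U 12)) (U 8)))) (U 1))) (half 1F 4 (near 2F 0 (half 3F 3 (V 27) (near 1F 0 (near 0F 2 (U 24) (half 3F 4
  (half 4F 4 (V 25) (U 24)) (U 8))) (near 0F 0 (half 3F 4 (V 26) (U 8)) (U 8)))) (half 0F 4 (half 3F 2 (V 31)
  (half 3F 4 (near 1F 0 (near 0F 0 (half 4F 3 (half 2F 4 (V 28) (half 3F 3 (V 29) (U 12))) (half 2F 1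
  (half 3F 3 (V 30) (half 4F 4 (V 28) (U 24))) (V 29))) (half 3F 3 (half 4F 4 (V 29) (U 24)) (U 8)))
  (near 0F 0 (half 2F 4 (half 3F 3 (V 30) (U 8)) (U 12)) (U 8))) (U 8))) (U 1))) (U 2))
tree (false ∷ false ∷ false ∷ true ∷ []) =
  near 3F 0 (near 1F 0 (near 2F 0 (U 0) (half 0F 4 (half 4F 4 (V 29) (half 0F 3 (half 2F 4 (V 21) (U 20))
  (U 17))) (U 1))) (half 4F 4 (near 2F 0 (half 4F 3 (V 27) (half 0F 4 (half 1F 4 (V 19) (U 18)) (U 17)))
  (half 0F 4 (half 4F 3 (V 31) (half 0F 3 (half 1F 4 (half 2F 4 (V 23) (U 20)) (U 18)) (U 17))) (U 1)))
  (U 16))) (half 4F 4 (near 0F 0 (near 1F 0 (near 2F 1 (U 24) (half 3F 4 (V 29) (half 2F 4 (half 3F 5 (V 28)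
  (U 8)) (U 12)))) (half 3F 5 (half 4F 3 (near 2F 0 (V 26) (half 3F 3 (V 31) (half 2F 4 (half 3F 4 (V 30)
  (U 8)) (U 12)))) (U 16)) (U 8))) (half 3F 5 (near 1F 0 (near 2F 0 (V 25) (half 0F 4 (half 3F 4 (V 29) (U 8))
  (U 1))) (half 3F 4 (half 4F 3 (near 2F 0 (V 27) (half 0F 4 (half 3F 3 (V 31) (U 8)) (U 1))) (U 16)) (U 8)))
  (U 8))) (U 16))
tree (false ∷ false ∷ true ∷ false ∷ []) =
  near 3F 0 (near 2F 0 (half 1F 4 (V 19) (near 4F 0 (U 0) (U 2))) (half 0F 4 (half 1F 4 (V 23) (near 4F 0
  (V 7) (U 2))) (U 1))) (half 0F 4 (half 1F 4 (half 2F 4 (half 4F 4 (near 2F 0 (near 4F 0 (half 3F 4 (V 11)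
  (half 0F 3 (half 1F 3 (V 31) (half 3F 5 (V 15) (U 10))) (half 1F 0 (half 3F 5 (V 27) (U 9)) (V 11))))
  (half 1F 3 (half 0F 3 (V 31) (half 3F 5 (V 27) (U 9))) (U 2))) (half 0F 3 (half 1F 3 (V 31) (half 3F 5
  (near 4F 0 (V 15) (U 2)) (U 10))) (U 1))) (U 16)) (U 4)) (U 2)) (U 1))
tree (false ∷ false ∷ true ∷ true ∷ []) =
  near 3F 0 (near 1F 0 (near 2F 0 (U 0) (half 0F 4 (half 4F 4 (V 21) (half 0F 3 (half 2F 4 (V 29) (U 20))
  (U 17))) (U 1))) (half 4F 4 (near 2F 0 (half 4F 3 (V 19) (half 0F 4 (half 1F 4 (V 27) (U 18)) (U 17)))
  (half 0F 4 (half 4F 3 (V 23) (half 0F 3 (half 1F 4 (half 2F 4 (V 31) (U 20)) (U 18)) (U 17))) (U 1)))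
  (U 16))) (half 0F 4 (half 1F 4 (half 2F 4 (near 1F 0 (near 2F 0 (half 3F 3 (V 25) (near 4F 0 (U 0)
  (half 3F 5 (half 0F 3 (half 3F 4 (V 29) (half 4F 4 (V 31) (U 24))) (half 3F 4 (half 4F 1 (V 27) (V 25))
  (U 9))) (U 8)))) (half 0F 3 (half 3F 4 (V 29) (near 4F 0 (V 15) (half 3F 5 (half 4F 4 (V 31) (U 24))
  (U 8)))) (U 1))) (half 4F 4 (near 2F 0 (half 3F 4 (V 27) (near 4F 0 (half 0F 3 (half 1F 3 (V 15) (half 3F 5
  (V 31) (U 10))) (half 1F 0 (half 3F 5 (V 11) (U 9)) (V 27))) (half 0F 3 (half 3F 5 (V 31) (U 8)) (U 9))))
  (half 0F 3 (half 3F 5 (V 31) (half 1F 3 (near 4F 0 (V 15) (U 8)) (U 10))) (U 1))) (U 16))) (U 4)) (U 2))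
  (U 1))
tree (false ∷ true ∷ false ∷ false ∷ []) =
  near 4F 0 (near 3F 0 (near 0F 2 (U 6) (half 2F 3 (V 15) (half 0F 4 (half 1F 4 (half 2F 4 (V 7) (U 4)) (U 6))
  (U 5)))) (half 2F 4 (near 0F 0 (near 1F 1 (U 8) (half 3F 5 (V 14) (U 8))) (half 2F 3 (half 3F 4 (V 15)
  (near 1F 0 (half 3F 5 (V 13) (U 8)) (U 8))) (U 4))) (U 4))) (half 1F 4 (half 3F 5 (near 3F 0 (half 2F 3
  (V 31) (half 0F 4 (near 0F 0 (half 2F 4 (V 30) (half 1F 3 (half 4F 4 (V 22) (U 20)) (U 6))) (half 1F 3
  (half 2F 4 (half 4F 4 (V 23) (U 20)) (U 4)) (U 6))) (U 5))) (half 2F 4 (near 0F 0 (half 3F 4 (V 30)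
  (near 1F 0 (half 4F 4 (V 28) (U 24)) (U 8))) (half 2F 3 (half 3F 3 (V 31) (near 1F 0 (half 3F 4 (half 4F 4
  (V 29) (U 24)) (U 8)) (U 8))) (U 4))) (U 4))) (U 8)) (U 2))
tree (false ∷ true ∷ false ∷ true ∷ []) =
  near 3F 0 (near 0F 0 (near 1F 1 (U 0) (half 4F 4 (half 1F 4 (V 22) (half 2F 4 (half 4F 3 (V 30) (U 18))
  (U 6))) (U 16))) (half 2F 4 (near 1F 0 (half 0F 4 (V 21) (half 2F 3 (half 4F 4 (V 29) (U 17)) (U 5)))
  (half 4F 4 (half 2F 3 (half 4F 3 (V 31) (half 0F 4 (half 1F 4 (V 23) (U 18)) (U 17))) (half 0F 4 (half 1F 4
  (V 23) (U 6)) (U 5))) (U 16))) (U 4))) (half 2F 4 (half 4F 4 (near 0F 0 (near 1F 0 (V 28) (half 3F 5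
  (half 4F 3 (V 30) (U 16)) (U 8))) (half 2F 3 (half 3F 5 (near 1F 0 (V 29) (half 3F 4 (half 4F 3 (V 31)
  (U 16)) (U 8))) (U 8)) (U 4))) (U 16)) (U 4))
tree (false ∷ true ∷ true ∷ false ∷ []) =
  near 3F 0 (near 0F 0 (near 4F 0 (U 0) (half 1F 4 (half 2F 4 (V 22) (half 1F 3 (half 4F 4 (V 30) (U 20))
  (U 6))) (U 2))) (half 2F 4 (near 4F 0 (half 2F 3 (V 7) (half 0F 4 (half 1F 4 (V 15) (U 6)) (U 5)))
  (half 1F 4 (half 2F 3 (V 23) (half 0F 4 (half 1F 3 (half 4F 4 (V 31) (U 20)) (U 6)) (U 5))) (U 2))) (U 4)))
  (half 0F 4 (half 1F 4 (half 4F 4 (near 0F 0 (near 2F 0 (half 1F 3 (V 27) (near 4F 0 (U 0) (U 2))) (half 3F 5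
  (near 4F 0 (half 3F 3 (V 14) (half 1F 3 (half 2F 4 (V 31) (half 3F 4 (V 30) (U 12))) (half 2F 1 (half 3F 4
  (V 15) (U 10)) (V 14)))) (half 1F 3 (half 2F 4 (V 31) (half 3F 4 (V 30) (U 12))) (U 2))) (U 8))) (half 2F 4
  (near 2F 0 (near 4F 0 (half 3F 4 (V 15) (half 0F 3 (half 1F 3 (V 27) (half 3F 5 (V 11) (U 10))) (half 1F 0
  (half 3F 5 (V 31) (U 9)) (V 15)))) (half 1F 3 (half 0F 3 (V 27) (half 3F 5 (V 31) (U 9))) (U 2))) (half 3F 5
  (half 1F 3 (V 31) (half 3F 4 (near 4F 0 (V 15) (U 2)) (U 10))) (U 8))) (U 4))) (U 16)) (U 2)) (U 1))
tree (false ∷ true ∷ true ∷ true ∷ []) =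
  near 3F 0 (near 0F 0 (near 1F 1 (U 0) (half 4F 4 (half 1F 4 (V 30) (half 2F 4 (half 4F 3 (V 22) (U 18))
  (U 6))) (U 16))) (half 2F 4 (near 1F 0 (half 0F 4 (V 29) (half 2F 3 (half 4F 4 (V 21) (U 17)) (U 5)))
  (half 4F 4 (half 0F 3 (half 1F 4 (V 31) (half 2F 3 (half 4F 3 (V 23) (U 18)) (U 6))) (half 1F 3 (half 0F 4
  (V 31) (half 2F 3 (half 4F 3 (V 23) (U 17)) (U 5))) (half 2F 0 (half 4F 0 (V 23) (V 31)) (V 31)))) (U 16)))
  (U 4))) (half 0F 4 (half 1F 4 (near 0F 0 (near 1F 0 (near 2F 2 (U 24) (half 3F 2 (V 28) (near 4F 0 (U 0)
  (half 3F 4 (half 3F 3 (half 2F 4 (V 29) (half 4F 1 (V 30) (V 28))) (half 2F 4 (half 4F 4 (V 31) (U 24))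
  (U 12))) (U 8))))) (half 4F 4 (half 3F 3 (V 30) (near 2F 0 (half 3F 5 (V 27) (near 4F 0 (U 0) (U 8)))
  (half 3F 5 (near 4F 0 (half 1F 3 (half 2F 4 (V 15) (half 3F 4 (V 14) (U 12))) (half 2F 1 (half 3F 4 (V 31)
  (U 10)) (V 30))) (half 2F 4 (half 3F 4 (V 31) (U 8)) (U 12))) (U 8)))) (U 16))) (half 2F 4 (near 1F 0
  (half 3F 3 (V 29) (near 2F 0 (near 4F 0 (U 0) (half 3F 5 (half 0F 3 (half 3F 4 (V 25) (half 4F 4 (V 27)
  (U 24))) (half 3F 4 (half 4F 1 (V 31) (V 29)) (U 9))) (U 8))) (half 3F 5 (near 4F 0 (V 15) (half 3F 4
  (half 4F 4 (V 31) (U 24)) (U 8))) (U 8)))) (half 4F 4 (half 3F 4 (V 31) (near 2F 0 (near 4F 0 (half 0F 3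
  (half 1F 3 (V 11) (half 3F 5 (V 27) (U 10))) (half 1F 0 (half 3F 5 (V 15) (U 9)) (V 31))) (half 0F 3
  (half 3F 5 (V 27) (U 8)) (U 9))) (half 1F 3 (half 3F 5 (near 4F 0 (V 15) (U 8)) (U 8)) (U 10)))) (U 16)))
  (U 4))) (U 2)) (U 1))
tree (true ∷ false ∷ false ∷ false ∷ []) =
  near 3F 0 (near 1F 0 (half 0F 4 (V 29) (near 2F 0 (U 0) (U 1))) (half 4F 4 (near 2F 0 (half 1F 4 (V 27)
  (half 0F 4 (half 4F 3 (V 19) (U 18)) (U 3))) (half 0F 4 (half 1F 4 (V 31) (half 0F 3 (half 2F 4 (half 4F 3
  (V 23) (U 18)) (U 6)) (U 3))) (U 1))) (U 16))) (half 1F 4 (near 0F 0 (near 1F 0 (near 2F 2 (U 24) (half 3F 2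
  (V 29) (near 4F 0 (U 8) (half 3F 4 (half 3F 3 (half 2F 4 (V 28) (half 4F 1 (V 31) (V 28))) (half 2F 4
  (half 4F 4 (V 30) (U 24)) (U 12))) (U 8))))) (half 4F 4 (half 3F 3 (V 31) (near 2F 0 (half 3F 5 (V 26)
  (near 4F 0 (U 8) (U 8))) (half 3F 5 (near 4F 0 (half 1F 3 (half 2F 4 (V 14) (half 3F 4 (V 15) (U 12)))
  (half 2F 1 (half 3F 4 (V 30) (U 10)) (V 15))) (half 2F 4 (half 3F 4 (V 30) (U 8)) (U 12))) (U 8)))) (U 16)))
  (half 3F 5 (near 1F 0 (near 2F 0 (half 3F 3 (V 25) (near 4F 0 (U 0) (half 3F 4 (half 4F 4 (V 27) (U 24))
  (U 8)))) (half 0F 4 (half 3F 2 (V 29) (half 3F 4 (near 4F 0 (V 15) (half 3F 3 (half 4F 4 (V 31) (U 24))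
  (U 8))) (U 8))) (U 1))) (half 4F 4 (near 2F 0 (half 3F 4 (V 27) (half 1F 3 (near 4F 0 (V 11) (U 8)) (U 10)))
  (half 0F 4 (half 3F 3 (V 31) (half 1F 3 (half 3F 4 (near 4F 0 (V 15) (U 8)) (U 8)) (U 10))) (U 1))) (U 16)))
  (U 8))) (U 2))
tree (true ∷ false ∷ false ∷ true ∷ []) =
  near 3F 0 (near 2F 0 (near 4F 0 (U 0) (half 1F 4 (half 0F 4 (V 19) (half 1F 3 (half 4F 4 (V 27) (U 17))
  (U 3))) (U 2))) (half 0F 4 (near 4F 0 (half 1F 4 (V 15) (half 0F 3 (half 2F 4 (V 7) (U 6)) (U 3)))
  (half 1F 4 (half 0F 3 (half 2F 4 (V 23) (half 1F 3 (half 4F 4 (V 31) (U 20)) (U 6))) (half 1F 3 (half 4F 4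
  (V 31) (U 17)) (U 3))) (U 2))) (U 1))) (half 1F 4 (half 4F 4 (near 0F 0 (near 2F 0 (half 1F 3 (V 26)
  (near 4F 0 (U 0) (U 2))) (half 3F 5 (near 4F 0 (half 3F 3 (V 15) (half 1F 3 (half 2F 4 (V 30) (half 3F 4
  (V 31) (U 12))) (half 2F 1 (half 3F 4 (V 14) (U 10)) (V 31)))) (half 1F 3 (half 2F 4 (V 30) (half 3F 4
  (V 31) (U 12))) (U 2))) (U 8))) (half 3F 5 (near 2F 0 (half 1F 3 (V 27) (half 3F 4 (near 4F 0 (V 11) (U 2))
  (U 10))) (half 0F 4 (half 3F 4 (half 1F 3 (V 31) (half 3F 3 (near 4F 0 (V 15) (U 2)) (U 10))) (U 8)) (U 1)))
  (U 8))) (U 16)) (U 2))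
tree (true ∷ false ∷ true ∷ false ∷ []) =
  near 3F 0 (near 1F 0 (half 0F 4 (V 21) (near 2F 0 (U 0) (U 1))) (half 4F 4 (near 2F 0 (half 1F 4 (V 19)
  (half 0F 4 (half 4F 3 (V 27) (U 18)) (U 3))) (half 0F 4 (half 1F 4 (V 23) (half 0F 3 (half 2F 4 (half 4F 3
  (V 31) (U 18)) (U 6)) (U 3))) (U 1))) (U 16))) (half 0F 4 (half 2F 4 (half 4F 4 (near 1F 0 (half 0F 3 (V 29)
  (near 2F 0 (half 3F 5 (V 25) (U 9)) (U 1))) (half 3F 5 (half 4F 3 (half 0F 3 (V 31) (near 2F 0 (half 3F 4
  (V 27) (U 9)) (U 1))) (U 16)) (U 8))) (U 16)) (U 4)) (U 1))
tree (true ∷ false ∷ true ∷ true ∷ []) =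
  near 3F 0 (near 2F 0 (near 4F 0 (U 0) (half 1F 4 (half 0F 4 (V 27) (half 1F 3 (half 4F 4 (V 19) (U 17))
  (U 3))) (U 2))) (half 0F 4 (near 4F 0 (half 1F 4 (V 7) (half 0F 3 (half 2F 4 (V 15) (U 6)) (U 3)))
  (half 1F 4 (half 0F 3 (half 2F 4 (V 31) (half 1F 3 (half 4F 4 (V 23) (U 20)) (U 6))) (half 1F 3 (half 4F 4
  (V 23) (U 17)) (U 3))) (U 2))) (U 1))) (half 0F 4 (half 2F 4 (near 1F 0 (near 2F 0 (half 3F 3 (V 27)
  (near 4F 0 (U 0) (half 3F 5 (half 0F 3 (half 3F 4 (V 31) (half 4F 4 (V 29) (U 24))) (half 3F 4 (half 4F 1
  (V 25) (V 27)) (U 9))) (U 8)))) (half 0F 3 (half 3F 4 (V 31) (near 4F 0 (V 13) (half 3F 5 (half 4F 4 (V 29)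
  (U 24)) (U 8)))) (U 1))) (half 3F 5 (near 2F 0 (near 4F 0 (half 0F 3 (V 15) (half 3F 4 (V 11) (U 9)))
  (half 1F 4 (half 3F 3 (V 27) (half 0F 3 (half 3F 4 (V 31) (U 8)) (U 9))) (U 2))) (half 0F 3 (near 4F 0
  (V 15) (half 1F 4 (half 3F 4 (V 31) (U 8)) (U 2))) (U 1))) (U 8))) (U 4)) (U 1))
tree (true ∷ true ∷ false ∷ false ∷ []) =
  near 4F 0 (near 3F 0 (near 0F 1 (U 0) (half 2F 4 (half 0F 4 (V 23) (half 1F 4 (half 2F 3 (V 31) (U 5))
  (U 3))) (U 4))) (half 1F 4 (half 2F 4 (near 0F 0 (half 1F 3 (V 14) (half 3F 5 (V 30) (U 10))) (half 2F 3
  (half 3F 4 (V 31) (half 1F 3 (half 3F 5 (V 15) (U 8)) (U 10))) (U 4))) (U 4)) (U 2))) (half 3F 5 (near 3F 0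
  (near 0F 0 (near 1F 2 (U 20) (half 4F 3 (V 22) (half 1F 4 (half 2F 4 (half 4F 4 (V 30) (U 16)) (U 20))
  (U 18)))) (half 2F 4 (near 1F 0 (half 2F 3 (V 29) (half 0F 4 (half 4F 4 (V 21) (U 20)) (U 5))) (half 4F 4
  (half 2F 3 (half 1F 4 (V 31) (half 0F 4 (half 4F 3 (V 23) (U 18)) (U 3))) (half 0F 4 (half 4F 3 (V 23)
  (U 20)) (U 5))) (U 16))) (U 4))) (half 1F 4 (half 2F 4 (near 0F 0 (half 4F 4 (V 30) (near 1F 0 (half 3F 4
  (V 28) (U 24)) (U 16))) (half 2F 3 (half 3F 4 (half 4F 4 (V 31) (near 1F 0 (half 3F 3 (V 29) (U 24))
  (U 16))) (U 8)) (U 4))) (U 4)) (U 2))) (U 8))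
tree (true ∷ true ∷ false ∷ true ∷ []) =
  near 3F 0 (near 0F 0 (half 1F 4 (V 22) (near 4F 0 (U 0) (U 2))) (half 2F 4 (near 4F 0 (half 0F 4 (V 7)
  (half 1F 4 (half 2F 3 (V 15) (U 5)) (U 3))) (half 1F 4 (half 0F 4 (V 23) (half 1F 3 (half 2F 3 (half 4F 4
  (V 31) (U 17)) (U 5)) (U 3))) (U 2))) (U 4))) (half 1F 4 (half 2F 4 (half 4F 4 (near 0F 0 (half 1F 3 (V 30)
  (half 3F 5 (near 4F 0 (V 14) (U 2)) (U 10))) (half 2F 3 (half 3F 5 (half 1F 3 (V 31) (half 3F 4 (near 4F 0
  (V 15) (U 2)) (U 10))) (U 8)) (U 4))) (U 16)) (U 4)) (U 2))
tree (true ∷ true ∷ true ∷ false ∷ []) =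
  near 3F 0 (near 0F 0 (near 1F 2 (U 20) (half 4F 3 (V 30) (half 1F 4 (half 2F 4 (half 4F 4 (V 22) (U 16))
  (U 20)) (U 18)))) (half 2F 4 (near 1F 0 (half 2F 3 (V 21) (half 0F 4 (half 4F 4 (V 29) (U 20)) (U 5)))
  (half 4F 4 (half 0F 3 (half 4F 3 (V 31) (half 1F 4 (half 2F 3 (V 23) (U 20)) (U 18))) (half 1F 3 (half 2F 3
  (V 23) (half 0F 4 (half 4F 0 (V 31) (V 23)) (U 5))) (half 2F 0 (half 1F 4 (V 23) (half 0F 4 (half 4F 0
  (V 31) (V 23)) (U 3))) (V 31)))) (U 16))) (U 4))) (half 0F 4 (half 4F 4 (near 0F 0 (near 1F 0 (near 2F 1
  (U 0) (half 3F 4 (V 28) (half 2F 4 (half 3F 5 (V 29) (U 8)) (U 12)))) (half 3F 5 (half 4F 3 (near 2F 0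
  (V 27) (half 3F 3 (V 30) (half 2F 4 (half 3F 4 (V 31) (U 8)) (U 12)))) (U 16)) (U 8))) (half 2F 4 (near 1F 0
  (half 3F 5 (V 29) (half 0F 3 (near 2F 0 (V 25) (U 8)) (U 9))) (half 3F 5 (half 4F 3 (half 3F 4 (V 31)
  (half 0F 3 (near 2F 0 (V 27) (U 8)) (U 9))) (U 16)) (U 8))) (U 4))) (U 16)) (U 1))
tree (true ∷ true ∷ true ∷ true ∷ []) =
  near 3F 0 (near 0F 0 (half 1F 4 (V 30) (near 4F 0 (U 0) (U 2))) (half 2F 4 (near 4F 0 (half 0F 4 (V 15)
  (half 1F 4 (half 2F 3 (V 7) (U 5)) (U 3))) (half 1F 4 (half 0F 4 (V 31) (half 1F 3 (half 2F 3 (half 4F 4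
  (V 23) (U 17)) (U 5)) (U 3))) (U 2))) (U 4))) (half 0F 4 (near 0F 0 (near 1F 0 (near 2F 2 (U 24) (half 3F 2
  (V 30) (near 4F 0 (U 8) (half 3F 4 (half 3F 3 (half 2F 4 (V 31) (half 4F 1 (V 28) (V 30))) (half 2F 4
  (half 4F 4 (V 29) (U 24)) (U 12))) (U 8))))) (near 2F 0 (near 4F 0 (U 8) (half 1F 4 (half 3F 4 (V 27) (U 8))
  (U 2))) (half 3F 4 (near 4F 0 (half 2F 4 (V 15) (half 3F 3 (V 14) (U 12))) (half 1F 4 (half 3F 2 (V 30)
  (half 2F 4 (half 3F 3 (V 31) (U 8)) (U 12))) (U 2))) (U 8)))) (half 2F 4 (near 1F 0 (half 3F 3 (V 31)
  (near 2F 0 (near 4F 0 (U 8) (half 3F 5 (half 0F 3 (half 3F 4 (V 27) (half 4F 4 (V 25) (U 24))) (half 3F 4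
  (half 4F 1 (V 29) (V 31)) (U 9))) (U 8))) (half 3F 5 (near 4F 0 (V 13) (half 3F 4 (half 4F 4 (V 29) (U 24))
  (U 8))) (U 8)))) (half 3F 5 (near 2F 0 (near 4F 0 (half 0F 3 (V 11) (half 3F 4 (V 15) (U 9))) (half 1F 4
  (half 3F 3 (V 31) (half 0F 3 (half 3F 4 (V 27) (U 8)) (U 9))) (U 2))) (half 3F 4 (near 4F 0 (V 15)
  (half 1F 4 (half 3F 3 (V 31) (U 8)) (U 2))) (U 8))) (U 8))) (U 4))) (U 1))

-- Upper bound: every vector of norm k + 1 can be shortened.

orthant : Box 5
orthant = replicate 5 ([] , sphereᴾ)

every : ∀ p → (Vec Bool p → Bool) → Bool
every zero    f = f []
every (suc p) f = every p (f ∘ (false ∷_)) ∧ every p (f ∘ (true ∷_))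

every-sound : ∀ (f : Vec Bool p → Bool) → T (every p f) → ∀ σ → T (f σ)
every-sound f ok []      = ok
every-sound {suc p} f ok (b ∷ σ) with to (T-∧ {every p (f ∘ (false ∷_))}) ok
every-sound f ok (false ∷ σ) | ok₁ , _ = every-sound (f ∘ (false ∷_)) ok₁ σ
every-sound f ok (true  ∷ σ) | _ , ok₂ = every-sound (f ∘ (true ∷_)) ok₂ σ

-- The first sign is fixed, which leaves 16 of the 32 orthants; `closer` reaches the others by
-- negation. The comparisons are between polynomials in m, so a single evaluation covers every m ≥
-- 1.
trees-check : T (every 4 λ σ → check (false ∷ σ) orthant (capped (tree σ)))
trees-check = tt

negative : ℤ → Bool
negative (+ _)    = false
negative -[1+ _ ] = true

absolute : Vec ℤ p → Vec ℤ p
absolute = map λ z → + ∣ z ∣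

0≤absolute : (a : Vec ℤ p) → All (+ 0 ≤_) (absolute a)
0≤absolute []       = []
0≤absolute (a ∷ as) = ℤ.+≤+ z≤n ∷ 0≤absolute as

sum-absolute : (a : Vec ℤ p) → sumℤ (absolute a) ≡ + norm a
sum-absolute []       = refl
sum-absolute (a ∷ as) = trans (cong (λ z → + ∣ a ∣ + z) (sum-absolute as)) (sym (ℤ.pos-+ ∣ a ∣ (norm as)))

-- Absolute values amount to a reflection in coordinate hyperplanes, applied to the point and the
-- lattice vector alike.
norm-absolute : (a v : Vec ℤ p) → norm (absolute a ⊝ zipWith signed (map negative a) v) ≡ norm (a ⊝ v)
norm-absolute []               []       = refl
norm-absolute (+ a ∷ as)       (v ∷ vs) = cong (∣ + a - v ∣ ℕ.+_) (norm-absolute as vs)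
norm-absolute (-[1+ a ] ∷ as)  (v ∷ vs) = cong₂ ℕ._+_
  (trans (cong ∣_∣ (eq (+ suc a) v)) (ℤ.∣-i∣≡∣i∣ (- + suc a - v))) (norm-absolute as vs)
  where
  eq : ∀ a v → a - - v ≡ - (- a - v)
  eq = solve-∀

inside-orthant : ∀ {x s} (a : Vec ℤ p) → + norm a ≤ ⟦ s ⟧ x → Inside x (absolute a) (replicate p ([] , s))
inside-orthant []       _ = []
inside-orthant (a ∷ as) h =
  (ℤ.+≤+ z≤n , ℤ.≤-trans (ℤ.+≤+ (ℕ.m≤m+n ∣ a ∣ (norm as))) h) ∷
  inside-orthant as (ℤ.≤-trans (ℤ.+≤+ (ℕ.m≤n+m (norm as) ∣ a ∣)) h)

norm-⊝-neg : (a v : Vec ℤ p) → norm (map -_ a ⊝ v) ≡ norm (a ⊝ scale (- + 1) v)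
norm-⊝-neg []       []       = refl
norm-⊝-neg (a ∷ as) (v ∷ vs) = cong₂ ℕ._+_
  (trans (cong ∣_∣ (eq a v)) (ℤ.∣-i∣≡∣i∣ (a - - + 1 * v))) (norm-⊝-neg as vs)
  where
  eq : ∀ a v → - a - v ≡ - (a - - + 1 * v)
  eq = solve-∀

Closer : ℤ → Vec ℤ 5 → Set
Closer x a = ∃[ c ] + 1 + + norm (a ⊝ comb c (map (at x) basis)) ≤ ⟦ sphereᴾ ⟧ x

closer⁺ : ∀ {x} → + 1 ≤ x → ∀ a as → + norm (+ a ∷ as) ≡ ⟦ sphereᴾ ⟧ x → Closer x (+ a ∷ as)
closer⁺ {x} 1≤x a as a≡ = proj₁ improved , subst (λ d → + 1 + + d ≤ ⟦ sphereᴾ ⟧ x)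
  (norm-absolute (+ a ∷ as) (comb (proj₁ improved) (map (at x) basis))) (proj₂ improved)
  where
  σ = map negative as
  improved = check-sound 1≤x (false ∷ σ) (0≤absolute (+ a ∷ as)) (trans (sum-absolute (+ a ∷ as)) a≡)
    orthant (capped (tree σ))
    (every-sound (λ σ → check (false ∷ σ) orthant (capped (tree σ))) trees-check σ)
    (inside-orthant (+ a ∷ as) (ℤ.≤-reflexive a≡))

closer : ∀ {x} → + 1 ≤ x → ∀ a → + norm a ≡ ⟦ sphereᴾ ⟧ x → Closer x a
closer 1≤x (+ a ∷ as) a≡ = closer⁺ 1≤x a as a≡
closer {x} 1≤x a@(-[1+ a₁ ] ∷ as) a≡ with closer⁺ 1≤x (suc a₁) (map -_ as) (trans (cong +_ (norm-map-neg a)) a≡)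
... | c , c≤ = scale (- + 1) c , subst (λ d → + 1 + + d ≤ ⟦ sphereᴾ ⟧ x)
  (trans (norm-⊝-neg a (comb c (map (at x) basis)))
    (cong (λ v → norm (a ⊝ v)) (sym (comb-scale (- + 1) c (map (at x) basis))))) c≤

shrink : ∀ x k → + 1 ≤ x → ⟦ sphereᴾ ⟧ x ≡ + suc k → ∀ {g n} → at x gensᴾ ≡ g → ⟦ orderᴾ ⟧ x ≡ n →
  ∀ a → norm a ≡ suc k → ∃[ b ] norm b ℕ.≤ k × n ∣ dot a g - dot b g
shrink x k 1≤x s≡ {g} {n} g≡ n≡ a a≡ with closer 1≤x a (trans (cong +_ a≡) (sym s≡))
... | c , c≤ = a ⊝ w , ℕ.s≤s⁻¹ (ℤ.drop‿+≤+ (subst (+ 1 + + norm (a ⊝ w) ≤_) s≡ c≤)) ,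
  subst (n ∣_) (trans (eq (dot a g) (dot w g)) (cong (λ z → dot a g - z) (sym (dot-⊝ a w g))))
    (∣dot-comb g c (basis-relations x g≡ n≡))
  where
  w = comb c (map (at x) basis)
  eq : ∀ a w → w ≡ a - (a - w)
  eq = solve-∀

-- The diameter for m ≥ 1.

⟦sphereᴾ⟧ : ∀ m → ⟦ sphereᴾ ⟧ (+ m) ≡ + suc (diameterOf m)
⟦sphereᴾ⟧ m = trans (eq (+ m)) (cong (λ z → + 1 + z) (⟦kᴾ⟧ m))
  where
  eq : ∀ x → + 3 + x * (+ 15 + x * + 0) ≡ + 1 + (+ 2 + x * (+ 15 + x * + 0))
  eq = solve-∀

module _ {n : ℕ} .{{_ : ℕ.NonZero n}} {g : Gens} {k : ℕ} where
  open Circulant n g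

  within-all : g 0F ≡ + 1 →
    (∀ a → norm a ≡ suc k → ∃[ b ] norm b ℕ.≤ k × + n ∣ value a - value b) → ∀ r → Within k r
  within-all g₁≡1 shrinks r with within (residue r)
    where
    cut : ∀ a r → norm a ℕ.≤ suc k → r ≋ value a → Within k r
    cut a r a≤k+1 r≋a with ℕ.m≤n⇒m<n∨m≡n a≤k+1
    ... | inj₁ a<k+1 = a , ℕ.s≤s⁻¹ a<k+1 , r≋a
    ... | inj₂ a≡k+1 with shrinks a a≡k+1
    ... | b , b≤k , a≋b = b , b≤k , ≋-trans r≋a (mod a≋b)
    within : ∀ j → Within k (+ j)
    within zero    = zeros , z≤n , ≋-reflexive (sym (dot-zeros (tabulate g)))
    within (suc j) with within j
    -- The first generator is 1, so adding the first unit vector represents j + 1 with norm at most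
    -- k + 1, and `cut` restores the bound k.
    ... | a , a≤k , j≋a = cut (unit (+ 1) 0F ⊕ a) (+ suc j)
      (ℕ.≤-trans (norm-⊕ (unit (+ 1) 0F) a) (s≤s a≤k))
      (subst (+ suc j ≋_) (sym value≡) (≋-+ (≋-reflexive {+ 1} refl) j≋a))
      where
      value≡ : value (unit (+ 1) 0F ⊕ a) ≡ + 1 + value a
      value≡ = trans (dot-⊕ (unit (+ 1) 0F) a (tabulate g))
        (cong (_+ value a) (trans (dot-unit (+ 1) 0F g) (trans (ℤ.*-identityˡ (g 0F)) g₁≡1)))
  ... | a , a≤k , r≋a = a , a≤k , ≋-trans (residue≋ r) r≋a

  lattice-diameter : ∀ x → + 1 ≤ x → ⟦ sphereᴾ ⟧ x ≡ + suc k →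
    at x gensᴾ ≡ tabulate g → ⟦ orderᴾ ⟧ x ≡ + n → g 0F ≡ + 1 →
    ∀ w → (∀ c → k ℕ.≤ norm (w ⊕ comb c (map (at x) basis))) → Diameter n g k
  lattice-diameter x 1≤x s≡ g≡ n≡ g₁≡1 w minimal = diameter k
    (within-all g₁≡1 (shrink x k 1≤x s≡ g≡ n≡))
    (value w) (λ { a (mod d) → congruent-norm x w minimal g≡ n≡ a d })

diameter-at : ∀ m → + 1 ≤ + m → ∀ w →
  (∀ c → diameterOf m ℕ.≤ norm (w ⊕ comb c (map (at (+ m)) basis))) →
  Diameter (order m) (gen (diameterOf m)) (diameterOf m)
diameter-at m 1≤m = lattice-diameter {order m} {gen (diameterOf m)} {diameterOf m} (+ m) 1≤m
  (⟦sphereᴾ⟧ m) (at-gensᴾ m) (sym (pos-horner orderCoeffs m)) refl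

diameter-suc : ∀ t → Diameter (order (suc t)) (gen (diameterOf (suc t))) (diameterOf (suc t))
diameter-suc t = diameter-at (suc t) (ℤ.+≤+ (s≤s z≤n)) (map +_ hole) coset-minimal
  where open LowerBound t using (hole; coset-minimal)

-- The case m = 0: order 45 and diameter 2.

module Order45 where
  open Circulant 45 (gen 2)

  -- Zero is included so that the sums of two steps fill the whole ball of radius 2.
  steps : List (Vec ℤ 5)
  steps = zeros ∷ List.concatMap (λ t → unit (+ 1) t ∷ unit (- + 1) t ∷ []) (List.allFin 5)

  steps-short : ListAll.All (λ a → norm a ℕ.≤ 1) steps
  steps-short = from-yes (ListAll.all? (λ a → norm a ℕ.≤? 1) steps)

  TwoSteps : ℕ → Set
  TwoSteps j = Any (λ a → Any (λ b → 45 ℕ.∣ ∣ + j - value (a ⊕ b) ∣) steps) steps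

  twoSteps? : ∀ j → Dec (TwoSteps j)
  twoSteps? j = Any.any? (λ a → Any.any? (λ b → 45 ℕ.∣? ∣ + j - value (a ⊕ b) ∣) steps) steps

  abstract
    two-steps : ∀ {j} → j ℕ.< 45 → TwoSteps j
    two-steps = from-yes (ℕ.allUpTo? twoSteps? 45)

  within : ∀ r → Within 2 r
  within r with find (two-steps (n%ℕd<d r 45))
  ... | a , a∈ , hit with find hit
  ... | b , b∈ , d = a ⊕ b ,
    ℕ.≤-trans (norm-⊕ a b) (ℕ.+-mono-≤ (ListAll.lookup steps-short a∈) (ListAll.lookup steps-short b∈)) ,
    ≋-trans (residue≋ r) (mod (∣ᵤ⇒∣ d))

  -- Modulo 45, the residue 2 is neither 0 nor one of ±1, ±3, ±5, ±12, ±19, so no sum of length 0 or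
  -- 1 reaches it.
  no-short : ∀ {ℓ r} → SignedSum ℓ r → + 2 ≋ r → 2 ℕ.≤ ℓ
  no-short nil           (mod d) = contradiction (∣⇒∣ᵤ d) (from-no (45 ℕ.∣? 2))
  no-short (add nil t)   (mod d) = contradiction (∣⇒∣ᵤ d)
    (from-yes (Fin.all? λ t → ¬? (45 ℕ.∣? ∣ + 2 - (gen 2 t + + 0) ∣)) t)
  no-short (sub nil t)   (mod d) = contradiction (∣⇒∣ᵤ d)
    (from-yes (Fin.all? λ t → ¬? (45 ℕ.∣? ∣ + 2 - (- gen 2 t + + 0) ∣)) t)
  no-short (add (add _ _) _) _ = s≤s (s≤s z≤n)
  no-short (add (sub _ _) _) _ = s≤s (s≤s z≤n)
  no-short (sub (add _ _) _) _ = s≤s (s≤s z≤n)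
  no-short (sub (sub _ _) _) _ = s≤s (s≤s z≤n)

  diameter-zero : Diameter 45 (gen 2) 2
  diameter-zero = diameter 2 within (+ 2) λ a → no-short (signedSum a (λ t → t))

diameter-gen : ∀ m → Diameter (order m) (gen (diameterOf m)) (diameterOf m)
diameter-gen zero    = Order45.diameter-zero
diameter-gen (suc t) = diameter-suc t

theorem5 : (k : ℕ) → 0 < k → k % 15 ≡ 2 →
    Σ ℕ (λ n → LCC10 k ≡ + n ×
    Σ Gens (λ g → Diameter n g k) ×
    Diameter n (gen k) k)
theorem5 k _ k%15≡2 = order m ,
  subst (λ k → LCC10 k ≡ + order m) (sym k≡) (LCC10≡order m) , (gen k , diam) , diam
  where
  m = k / 15
  k≡ : k ≡ diameterOf m
  k≡ = trans (m≡m%n+[m/n]*n k 15)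
    (trans (cong (ℕ._+ m ℕ.* 15) k%15≡2) (trans (ℕ.+-comm 2 (m ℕ.* 15)) (cong (ℕ._+ 2) (ℕ.*-comm m 15))))
  diam : Diameter (order m) (gen k) k
  diam = subst (λ k → Diameter (order m) (gen k) k) (sym k≡) (diameter-gen m)
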